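{- The following problem is undecidable: given a TPTL-formula $\varphi$, decide whether there exists an MTL-formula equivalent to $\varphi$ (i.e., satisfied by exactly the same data words).
   Context: Let $\mathcal{P}$ be a finite set of propositional variables. A data word is an infinite sequence $w=(P_0,d_0)(P_1,d_1)\dots$ with $P_i\subseteq\mathcal{P}$ and $d_i\in\mathbb{N}$. Intervals $I$ are (half-)open or (half-)closed intervals of integers with endpoints in $\mathbb{Z}\cup\{\pm\infty\}$. MTL formulas: $\varphi::=p\mid\neg\varphi\mid\varphi_1\wedge\varphi_2\mid\varphi_1\mathsf{U}_I\varphi_2$, with $(w,i)\models\varphi_1\mathsf{U}_I\varphi_2$ iff there is $j>i$ with $(w,j)\models\varphi_2$, $d_j-d_i\in I$, and $(w,k)\models\varphi_1$ for all $i<k<j$; $(w,i)\models p$ iff $p\in P_i$; $w\models\varphi$ iff $(w,0)\models\varphi$. TPTL formulas: $\varphi::=p\mid x\in I\mid\neg\varphi\mid\varphi_1\wedge\varphi_2\mid\varphi_1\mathsf{U}\varphi_2\mid x.\varphi$ with register variables $x$; with a valuation $\nu$ of registers in $\mathbb{N}$: $(w,i,\nu)\models x\in I$ iff $d_i-\nu(x)\in I$; $(w,i,\nu)\models x.\varphi$ iff $(w,i,\nu[x\mapsto d_i])\models\varphi$; $(w,i,\nu)\models\varphi_1\mathsf{U}\varphi_2$ iff there is $j>i$ with $(w,j,\nu)\models\varphi_2$ and $(w,k,\nu)\models\varphi_1$ for all $i<k<j$. $w\models\varphi$ iff $(w,0,\nu_0)\models\varphi$ with $\nu_0$ mapping every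 register to $d_0$. -}

module Defs where

open import Data.Nat using (ℕ; zero; suc; _+_; _*_; _∸_; _^_; _<_)
open import Data.Integer as ℤ using (ℤ; +_; -[1+_])
open import Data.Fin using (Fin; toℕ)
open import Data.Vec using (Vec; []; _∷_)
open import Data.Bool using (Bool; true; false)
open import Data.Product using (Σ; _×_; _,_)
open import Data.Unit using (⊤)
open import Data.Empty using (⊥)
open import Relation.Nullary using (¬_)
open import Relation.Binary.PropositionalEquality using (_≡_)

data Bound : Set where
  -∞ +∞ : Bound
  fin   : ℤ → Bound

record Interval : Set where
  constructor interval
  field
    lo hi             : Bound
    loClosed hiClosed : Bool

lowerOK : Bound → Bool → ℤ → Set
lowerOK -∞      _     z = ⊤
lowerOK +∞      _     z = ⊥
lowerOK (fin a) true  z = a ℤ.≤ z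
lowerOK (fin a) false z = a ℤ.< z

upperOK : Bound → Bool → ℤ → Set
upperOK -∞      _     z = ⊥
upperOK +∞      _     z = ⊤
upperOK (fin b) true  z = z ℤ.≤ b
upperOK (fin b) false z = z ℤ.< b

_∈I_ : ℤ → Interval → Set
z ∈I interval lo hi lc hc = lowerOK lo lc z × upperOK hi hc z

-- Data words over the propositions Fin k:  w = (P₀,d₀)(P₁,d₁)…

record DataWord (k : ℕ) : Set where
  field
    P : ℕ → Fin k → Bool     -- P i p ≡ true  iff  p ∈ P_i
    d : ℕ → ℕ

open DataWord public

diff : ∀ {k} → DataWord k → ℕ → ℕ → ℤ
diff w j i = (+ d w j) ℤ.- (+ d w i)

data MTL (k : ℕ) : Set where
  prop : Fin k → MTL k
  ¬ₘ_  : MTL k → MTL k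
  _∧ₘ_ : MTL k → MTL k → MTL k
  _U[_]_ : MTL k → Interval → MTL k → MTL k

_∣_⊨ₘ_ : ∀ {k} → DataWord k → ℕ → MTL k → Set
w ∣ i ⊨ₘ prop p = P w i p ≡ true
w ∣ i ⊨ₘ (¬ₘ φ) = ¬ (w ∣ i ⊨ₘ φ)
w ∣ i ⊨ₘ (φ ∧ₘ ψ) = (w ∣ i ⊨ₘ φ) × (w ∣ i ⊨ₘ ψ)
w ∣ i ⊨ₘ (φ U[ I ] ψ) =
  Σ ℕ λ j → i < j × (w ∣ j ⊨ₘ ψ) × (diff w j i ∈I I)
          × (∀ m → i < m → m < j → w ∣ m ⊨ₘ φ)

_⊨ₘ_ : ∀ {k} → DataWord k → MTL k → Set
w ⊨ₘ φ = w ∣ 0 ⊨ₘ φ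

-- TPTL (register variables are natural numbers)

data TPTL (k : ℕ) : Set where
  prop  : Fin k → TPTL k
  _∈ᵣ_  : ℕ → Interval → TPTL k
  ¬ₜ_   : TPTL k → TPTL k
  _∧ₜ_  : TPTL k → TPTL k → TPTL k
  _Uₜ_  : TPTL k → TPTL k → TPTL k
  bind  : ℕ → TPTL k → TPTL k

Valuation : Set
Valuation = ℕ → ℕ

update : Valuation → ℕ → ℕ → Valuation
update ν x v y with x Data.Nat.≟ y
  where import Data.Nat
... | Relation.Nullary.yes _ = v
... | Relation.Nullary.no  _ = ν y

_∣_∣_⊨ₜ_ : ∀ {k} → DataWord k → ℕ → Valuation → TPTL k → Set
w ∣ i ∣ ν ⊨ₜ prop p = P w i p ≡ true
w ∣ i ∣ ν ⊨ₜ (x ∈ᵣ I) = ((+ d w i) ℤ.- (+ ν x)) ∈I I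
w ∣ i ∣ ν ⊨ₜ (¬ₜ φ) = ¬ (w ∣ i ∣ ν ⊨ₜ φ)
w ∣ i ∣ ν ⊨ₜ (φ ∧ₜ ψ) = (w ∣ i ∣ ν ⊨ₜ φ) × (w ∣ i ∣ ν ⊨ₜ ψ)
w ∣ i ∣ ν ⊨ₜ (φ Uₜ ψ) =
  Σ ℕ λ j → i < j × (w ∣ j ∣ ν ⊨ₜ ψ) × (∀ m → i < m → m < j → w ∣ m ∣ ν ⊨ₜ φ)
w ∣ i ∣ ν ⊨ₜ bind x φ = w ∣ i ∣ update ν x (d w i) ⊨ₜ φ

_⊨ₜ_ : ∀ {k} → DataWord k → TPTL k → Set
w ⊨ₜ φ = w ∣ 0 ∣ (λ _ → d w 0) ⊨ₜ φ

MTLDefinable : ∀ {k} → TPTL k → Set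
MTLDefinable {k} φ =
  Σ (MTL k) λ ψ → ∀ (w : DataWord k) → ((w ⊨ₜ φ) → (w ⊨ₘ ψ)) × ((w ⊨ₘ ψ) → (w ⊨ₜ φ))

pair : ℕ → ℕ → ℕ
pair a b = (2 ^ a) * (2 * b + 1) ∸ 1

encℤ : ℤ → ℕ
encℤ (+ n)    = 2 * n
encℤ -[1+ n ] = 2 * n + 1

encBool : Bool → ℕ
encBool false = 0
encBool true  = 1

encBound : Bound → ℕ
encBound -∞      = pair 0 0
encBound +∞      = pair 1 0
encBound (fin z) = pair 2 (encℤ z)

encInterval : Interval → ℕ
encInterval (interval lo hi lc hc) =
  pair (pair (encBound lo) (encBound hi)) (pair (encBool lc) (encBool hc))

encTPTL : ∀ {k} → TPTL k → ℕ
encTPTL (prop p)  = pair 0 (toℕ p)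
encTPTL (x ∈ᵣ I)  = pair 1 (pair x (encInterval I))
encTPTL (¬ₜ φ)    = pair 2 (encTPTL φ)
encTPTL (φ ∧ₜ ψ)  = pair 3 (pair (encTPTL φ) (encTPTL ψ))
encTPTL (φ Uₜ ψ)  = pair 4 (pair (encTPTL φ) (encTPTL ψ))
encTPTL (bind x φ) = pair 5 (pair x (encTPTL φ))

code : (k : ℕ) → TPTL k → ℕ
code k φ = pair k (encTPTL φ)

data PR : ℕ → Set where
  Z    : ∀ {n} → PR n
  S    : PR 1
  proj : ∀ {n} → Fin n → PR n
  comp : ∀ {m n} → PR m → Vec (PR n) m → PR n
  prec : ∀ {n} → PR n → PR (suc (suc n)) → PR (suc n)
  mu   : ∀ {n} → PR (suc n) → PR n

lookupV : ∀ {n} → Vec ℕ n → Fin n → ℕ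
lookupV (x ∷ xs) Fin.zero    = x
  where import Data.Fin as Fin
lookupV (x ∷ xs) (Fin.suc i) = lookupV xs i
  where import Data.Fin as Fin

mutual
  data _[_]⇓_ : ∀ {n} → PR n → Vec ℕ n → ℕ → Set where
    zero⇓ : ∀ {n} {xs : Vec ℕ n} → Z [ xs ]⇓ 0
    succ⇓ : ∀ {x} → S [ x ∷ [] ]⇓ suc x
    proj⇓ : ∀ {n} {xs : Vec ℕ n} (i : Fin n) → proj i [ xs ]⇓ lookupV xs i
    comp⇓ : ∀ {m n} {f : PR m} {gs : Vec (PR n) m} {xs ys y} →
            gs [ xs ]⇓* ys → f [ ys ]⇓ y → comp f gs [ xs ]⇓ y
    prec0⇓ : ∀ {n} {f : PR n} {g xs y} → f [ xs ]⇓ y → prec f g [ 0 ∷ xs ]⇓ y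
    precS⇓ : ∀ {n} {f : PR n} {g xs t r y} →
             prec f g [ t ∷ xs ]⇓ r → g [ t ∷ r ∷ xs ]⇓ y →
             prec f g [ suc t ∷ xs ]⇓ y
    mu⇓   : ∀ {n} {f : PR (suc n)} {xs y} →
            f [ y ∷ xs ]⇓ 0 →
            (∀ z → z < y → Σ ℕ λ v → f [ z ∷ xs ]⇓ suc v) →
            mu f [ xs ]⇓ y

  data _[_]⇓*_ : ∀ {m n} → Vec (PR n) m → Vec ℕ n → Vec ℕ m → Set where
    []⇓  : ∀ {n} {xs : Vec ℕ n} → [] [ xs ]⇓* []
    _∷⇓_ : ∀ {m n} {g : PR n} {gs : Vec (PR n) m} {xs y ys} →
           g [ xs ]⇓ y → gs [ xs ]⇓* ys → (g ∷ gs) [ xs ]⇓* (y ∷ ys)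

DecidesMTLDefinability : PR 1 → Set
DecidesMTLDefinability e =
  ∀ (k : ℕ) (φ : TPTL k) →
    (MTLDefinable φ → e [ code k φ ∷ [] ]⇓ 1) ×
    (¬ MTLDefinable φ → e [ code k φ ∷ [] ]⇓ 0)

{-# OPTIONS --safe #-}

-- Let e be a decision procedure.  For a formula R, let Ψ R be the conjunction of
-- the following two formulas, where x is the code of R:
--   (1) some marked position has a datum above the first datum of the word,
--       and its successor has a datum below it;
--   (2) at some later position, R holds and the next datum is x (relative to the
--       current one).
-- A program D can be turned into a formula R such that (2) holds for some word iff
-- D maps x to 1: the word then has to contain a derivation of D[x] ⇓ 1 in a system
-- of Horn clauses, every fact being justified by facts further to the right.
-- If (2) is unsatisfiable then Ψ R is equivalent to false.  Otherwise Ψ R is not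
-- MTL-definable: let a long staircase of descending data with large gaps, marked
-- on every other step, precede the run, and let the first datum move through the
-- gaps.  An MTL formula changes its truth value only boundedly often, since each
-- outermost until is monotone in the first datum once the data above it and those
-- below it are considered separately; but (1) changes from each gap to the next.
-- Now apply this to the program D that maps the code of R to e (code of Ψ R).

module Submission where

open import Defs
open import Relation.Nullary using (¬_; yes; no)
open import Data.Product using (Σ; ∃; _×_; _,_; proj₁; proj₂; map₂)
open import Data.Sum as Sum using (_⊎_; inj₁; inj₂)
open import Data.Unit using (⊤; tt)
open import Data.Empty using (⊥-elim)
open import Data.Bool using (Bool; true; false; not)
open import Data.Nat using (ℕ; zero; suc; _+_; _*_; _∸_; _^_; _<_; _≤_; z≤n; s≤s; _≟_)
open import Data.Nat.Properties
open import Data.Nat.ListAction using (sum)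
open import Data.Integer using (+_; -[1+_])
import Data.Integer as ℤ
import Data.Integer.Properties as ℤₚ
open import Data.Fin using (Fin; toℕ; _↑ˡ_; _↑ʳ_)
open import Data.Fin.Properties using (pigeonhole; toℕ<n)
open import Data.Vec as Vec using (Vec; []; _∷_; toList; tabulate)
open import Data.Vec.Properties using (toList-map; toList-injective; length-toList; lookup-++ˡ; lookup-++ʳ; lookup-map; tabulate-∘; tabulate-cong; tabulate∘lookup; cast-is-id)
open import Data.List as List using (List; []; _∷_; _++_; length; map; [_]; applyUpTo)
open import Data.List.Properties using (map-++; ∷-injective; length-map; length-++)
open import Data.List.Membership.Propositional using (_∈_; _∉_)
open import Data.List.Membership.Propositional.Properties using (∈-++⁺ˡ; ∈-++⁺ʳ)
import Data.List.Membership.DecPropositional as DecMembership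
open import Data.List.Relation.Unary.Any using (here; there; index)
open import Data.List.Relation.Unary.Any.Properties using (lookup-index)
open import Data.List.Relation.Unary.All using (All; []; _∷_)
open import Function using (_∘_; id; case_of_)
open import Relation.Nullary.Negation using (contradiction)
open import Relation.Nullary.Decidable using (¬¬-excluded-middle; decidable-stable)
open import Relation.Binary.Definitions using (tri<; tri≈; tri>)
open import Relation.Binary.PropositionalEquality using (_≡_; _≢_; refl; sym; trans; cong; cong₂; subst; module ≡-Reasoning)

true≢false : true ≢ false
true≢false ()

-- Evaluation of recursive functions by Horn clauses

-- The variables of a clause are three scalars followed by two vectors, of
-- lengths k and n; var c i denotes c plus the value of the i-th variable.
data Term (k n : ℕ) : Set where
  num : ℕ → Term k n
  var : ℕ → Fin (3 + (k + n)) → Term k n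

eval : ∀ {k n} → (ℕ → ℕ) → Term k n → ℕ
eval ρ (num c)   = c
eval ρ (var c i) = c + ρ (toℕ i)

evals : ∀ {k n} → (ℕ → ℕ) → List (Term k n) → List ℕ
evals ρ = map (eval ρ)

record Clause : Set where
  constructor clause
  field
    {k n} : ℕ
    head  : List (Term k n)
    body  : List (ℕ × List (Term k n))

open Clause using (head; body)

Program : Set
Program = List (List Clause)

data At {A : Set} (x : A) : ℕ → List A → Set where
  here  : ∀ {xs} → At x 0 (x ∷ xs)
  there : ∀ {y n xs} → At x n xs → At x (suc n) (y ∷ xs)

At-unique : ∀ {A : Set} {x y : A} {n xs} → At x n xs → At y n xs → x ≡ y
At-unique here      here      = refl
At-unique (there p) (there q) = At-unique p q

At-++ : ∀ {A : Set} {x : A} {n xs} ys → At x n xs → At x n (xs ++ ys)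
At-++ ys here      = here
At-++ ys (there p) = there (At-++ ys p)

At-last : ∀ {A : Set} (x : A) xs → At x (length xs) (xs ++ [ x ])
At-last x []       = here
At-last x (y ∷ xs) = there (At-last x xs)

data Derivable (Γ : Program) : ℕ → List ℕ → Set where
  derive : ∀ {m cs c l} → At cs m Γ → c ∈ cs → (ρ : ℕ → ℕ) → l ≡ evals ρ (head c) →
           All (λ a → Derivable Γ (proj₁ a) (evals ρ (proj₂ a))) (body c) →
           Derivable Γ m l

-- A post-fixed point of the clauses, not their least model: in an infinite word justifications may
-- go on forever, so no derivation can be extracted from it. The double negation absorbs the encoded
-- disjunctions of TPTL, and the length guard reflects that words do not delimit argument lists.
Closed : Program → (ℕ → List ℕ → Set) → Set
Closed Γ M = ∀ {m l} → M m l →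
  ¬ ¬ (∃ λ cs → ∃ λ c → ∃ λ ρ → At cs m Γ × c ∈ cs ×
       (length l ≡ length (head c) → l ≡ evals ρ (head c)) ×
       All (λ a → M (proj₁ a) (evals ρ (proj₂ a))) (body c))

module _ {k n : ℕ} where

  s₀ s₁ s₂ : ℕ → Term k n
  s₀ c = var c Fin.zero
  s₁ c = var c (Fin.suc Fin.zero)
  s₂ c = var c (Fin.suc (Fin.suc Fin.zero))

  ysT : Vec (Term k n) k
  ysT = tabulate (λ i → var 0 (3 ↑ʳ (i ↑ˡ n)))

  xsT : Vec (Term k n) n
  xsT = tabulate (λ i → var 0 (3 ↑ʳ (k ↑ʳ i)))

  Y X : List (Term k n)
  Y = toList ysT
  X = toList xsT

-- Convention for the clauses of functions: a fact lists the output, or the vector of outputs, in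
-- front of the arguments.
zeroC : ℕ → List Clause
zeroC n = [ clause (num 0 ∷ X {0} {n}) [] ]

succC : List Clause
succC = [ clause (s₀ {0} {0} 1 ∷ s₀ 0 ∷ []) [] ]

projC : ∀ {n} → Fin n → List Clause
projC i = [ clause (Vec.lookup (xsT {0}) i ∷ X) [] ]

compC : (k n f gs : ℕ) → List Clause
compC k n f gs =
  [ clause (s₀ 0 ∷ X {k} {n}) ((gs , Y ++ X) ∷ (f , s₀ 0 ∷ Y) ∷ []) ]

nilC : ℕ → List Clause
nilC n = [ clause (X {0} {n}) [] ]

consC : (k n g gs : ℕ) → List Clause
consC k n g gs =
  [ clause (s₀ 0 ∷ Y {k} {n} ++ X) ((g , s₀ 0 ∷ X) ∷ (gs , Y ++ X) ∷ []) ]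

precC : (n self f g : ℕ) → List Clause
precC n self f g =
    clause (s₀ 0 ∷ num 0 ∷ X {0} {n}) [ (f , s₀ 0 ∷ X) ]
  ∷ clause (s₀ 0 ∷ s₁ 1 ∷ X {0} {n})
           ((self , s₂ 0 ∷ s₁ 0 ∷ X) ∷ (g , s₀ 0 ∷ s₁ 0 ∷ s₂ 0 ∷ X) ∷ [])
  ∷ []

-- The fact (y , xs) is derivable iff f has a positive value at (z , xs) for all z < y.
belowC : (n self f : ℕ) → List Clause
belowC n self f =
    clause (num 0 ∷ X {0} {n}) []
  ∷ clause (s₀ 1 ∷ X {0} {n}) ((self , s₀ 0 ∷ X) ∷ (f , s₁ 1 ∷ s₀ 0 ∷ X) ∷ [])
  ∷ []

muC : (n below f : ℕ) → List Clause
muC n below f =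
  [ clause (s₀ 0 ∷ X {0} {n}) ((below , s₀ 0 ∷ X) ∷ (f , num 0 ∷ s₀ 0 ∷ X) ∷ []) ]

-- Compilation of recursive functions into Horn programs

mutual
  data Implements (Γ : Program) : ∀ {n} → ℕ → PR n → Set where
    Zᵢ : ∀ {n m} → At (zeroC n) m Γ → Implements Γ m (Z {n})
    Sᵢ : ∀ {m} → At succC m Γ → Implements Γ m S
    projᵢ : ∀ {n m} {i : Fin n} → At (projC i) m Γ → Implements Γ m (proj i)
    compᵢ : ∀ {k n m a b f} {gs : Vec (PR n) k} → At (compC k n a b) m Γ →
            Implements Γ a f → Implements* Γ b gs → Implements Γ m (comp f gs)
    precᵢ : ∀ {n m a b} {f : PR n} {g} → At (precC n m a b) m Γ →
            Implements Γ a f → Implements Γ b g → Implements Γ m (prec f g)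
    muᵢ : ∀ {n m a b} {f : PR (suc n)} → At (muC n b a) m Γ → At (belowC n b a) b Γ →
          Implements Γ a f → Implements Γ m (mu f)

  data Implements* (Γ : Program) : ∀ {k n} → ℕ → Vec (PR n) k → Set where
    nilᵢ : ∀ {n m} → At (nilC n) m Γ → Implements* Γ m ([] {A = PR n})
    consᵢ : ∀ {k n m a b g} {gs : Vec (PR n) k} → At (consC k n a b) m Γ →
            Implements Γ a g → Implements* Γ b gs → Implements* Γ m (g ∷ gs)

_⊑_ : Program → Program → Set
Γ ⊑ Δ = ∀ {cs m} → At cs m Γ → At cs m Δ

mutual
  weaken : ∀ {Γ Δ n m} {p : PR n} → Γ ⊑ Δ → Implements Γ m p → Implements Δ m p
  weaken s (Zᵢ x)        = Zᵢ (s x)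
  weaken s (Sᵢ x)        = Sᵢ (s x)
  weaken s (projᵢ x)     = projᵢ (s x)
  weaken s (compᵢ x a b) = compᵢ (s x) (weaken s a) (weaken* s b)
  weaken s (precᵢ x a b) = precᵢ (s x) (weaken s a) (weaken s b)
  weaken s (muᵢ x y a)   = muᵢ (s x) (s y) (weaken s a)

  weaken* : ∀ {Γ Δ k n m} {ps : Vec (PR n) k} → Γ ⊑ Δ → Implements* Γ m ps → Implements* Δ m ps
  weaken* s (nilᵢ x)      = nilᵢ (s x)
  weaken* s (consᵢ x a b) = consᵢ (s x) (weaken s a) (weaken* s b)

mutual
  compile : ∀ {n} Γ (p : PR n) → ∃ λ Δ → Γ ⊑ Δ × ∃ λ m → Implements Δ m p
  compile Γ Z = _ , At-++ _ , _ , Zᵢ (At-last _ Γ)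
  compile Γ S = _ , At-++ _ , _ , Sᵢ (At-last _ Γ)
  compile Γ (proj i) = _ , At-++ _ , _ , projᵢ (At-last _ Γ)
  compile Γ (comp f gs) with compile Γ f
  ... | Δ , s , a , A with compile* Δ gs
  ...   | Θ , t , b , B =
          _ , At-++ _ ∘ t ∘ s , _ ,
          compᵢ (At-last _ Θ) (weaken (At-++ _ ∘ t) A) (weaken* (At-++ _) B)
  compile Γ (prec f g) with compile Γ f
  ... | Δ , s , a , A with compile Δ g
  ...   | Θ , t , b , B =
          _ , At-++ _ ∘ t ∘ s , _ ,
          precᵢ (At-last _ Θ) (weaken (At-++ _ ∘ t) A) (weaken (At-++ _) B)
  compile Γ (mu f) with compile Γ f
  ... | Δ , s , a , A =
          _ , At-++ _ ∘ At-++ _ ∘ s , _ ,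
          muᵢ (At-last _ (Δ ++ _)) (At-++ _ (At-last (belowC _ _ a) Δ))
              (weaken (At-++ _ ∘ At-++ _) A)

  compile* : ∀ {k n} Γ (ps : Vec (PR n) k) → ∃ λ Δ → Γ ⊑ Δ × ∃ λ m → Implements* Δ m ps
  compile* Γ [] = _ , At-++ _ , _ , nilᵢ (At-last _ Γ)
  compile* Γ (g ∷ gs) with compile Γ g
  ... | Δ , s , a , A with compile* Δ gs
  ...   | Θ , t , b , B =
          _ , At-++ _ ∘ t ∘ s , _ ,
          consᵢ (At-last _ Θ) (weaken (At-++ _ ∘ t) A) (weaken* (At-++ _) B)

-- Completeness: evaluations yield derivations

nth : ∀ {n} → Vec ℕ n → ℕ → ℕ
nth []       _       = 0
nth (x ∷ xs) zero    = x
nth (x ∷ xs) (suc i) = nth xs i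

nth-toℕ : ∀ {n} (xs : Vec ℕ n) i → nth xs (toℕ i) ≡ Vec.lookup xs i
nth-toℕ (x ∷ xs) Fin.zero    = refl
nth-toℕ (x ∷ xs) (Fin.suc i) = nth-toℕ xs i

lookupV≡lookup : ∀ {n} (xs : Vec ℕ n) i → lookupV xs i ≡ Vec.lookup xs i
lookupV≡lookup (x ∷ xs) Fin.zero    = refl
lookupV≡lookup (x ∷ xs) (Fin.suc i) = lookupV≡lookup xs i

module _ {k n : ℕ} (a b c : ℕ) (ys : Vec ℕ k) (xs : Vec ℕ n) where

  assign : ℕ → ℕ
  assign = nth (a ∷ b ∷ c ∷ ys Vec.++ xs)

  map-ysT : Vec.map (eval assign) (ysT {k} {n}) ≡ ys
  map-ysT = trans (sym (tabulate-∘ _ _)) (trans (tabulate-cong step) (tabulate∘lookup ys))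
    where step : ∀ i → nth (ys Vec.++ xs) (toℕ (i ↑ˡ n)) ≡ Vec.lookup ys i
          step i = trans (nth-toℕ (ys Vec.++ xs) _) (lookup-++ˡ ys xs i)

  map-xsT : Vec.map (eval assign) (xsT {k} {n}) ≡ xs
  map-xsT = trans (sym (tabulate-∘ _ _)) (trans (tabulate-cong step) (tabulate∘lookup xs))
    where step : ∀ i → nth (ys Vec.++ xs) (toℕ (k ↑ʳ i)) ≡ Vec.lookup xs i
          step i = trans (nth-toℕ (ys Vec.++ xs) _) (lookup-++ʳ ys xs i)

  evals-Y : evals assign (Y {k} {n}) ≡ toList ys
  evals-Y = trans (sym (toList-map _ ysT)) (cong toList map-ysT)

  evals-X : evals assign (X {k} {n}) ≡ toList xs
  evals-X = trans (sym (toList-map _ xsT)) (cong toList map-xsT)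

  evals-Y++X : evals assign (Y {k} {n} ++ X) ≡ toList ys ++ toList xs
  evals-Y++X = trans (map-++ (eval assign) Y X) (cong₂ _++_ evals-Y evals-X)

module _ {Γ : Program} where

  private
    via : ∀ {m l l′} → l ≡ l′ → Derivable Γ m l′ → Derivable Γ m l
    via refl D = D

  mutual
    complete : ∀ {n m} {p : PR n} {xs y} → Implements Γ m p → p [ xs ]⇓ y →
               Derivable Γ m (y ∷ toList xs)
    complete (Zᵢ x) (zero⇓ {xs = xs}) =
      derive x (here refl) (assign 0 0 0 [] xs) (cong (0 ∷_) (sym (evals-X 0 0 0 [] xs))) []
    complete (Sᵢ x) (succ⇓ {a}) = derive x (here refl) (assign a 0 0 [] []) refl []
    complete (projᵢ x) (proj⇓ {xs = xs} i) =
      derive x (here refl) ρ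
        (cong₂ _∷_ (trans (lookupV≡lookup xs i)
                     (trans (cong (λ v → Vec.lookup v i) (sym (map-xsT 0 0 0 [] xs)))
                            (lookup-map i (eval ρ) xsT)))
                   (sym (evals-X 0 0 0 [] xs))) []
      where ρ = assign 0 0 0 [] xs
    complete (compᵢ x F G) (comp⇓ {xs = xs} {ys = ys} {y = y} Gs D) =
      derive x (here refl) (assign y 0 0 ys xs) (cong (y ∷_) (sym (evals-X y 0 0 ys xs)))
        (via (evals-Y++X y 0 0 ys xs) (complete* G Gs)
         ∷ via (cong (y ∷_) (evals-Y y 0 0 ys xs)) (complete F D) ∷ [])
    complete (precᵢ x F G) (prec0⇓ {xs = xs} {y = y} D) =
      derive x (here refl) (assign y 0 0 [] xs) (cong (λ l → y ∷ 0 ∷ l) (sym (evals-X y 0 0 [] xs)))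
        (via (cong (y ∷_) (evals-X y 0 0 [] xs)) (complete F D) ∷ [])
    complete I@(precᵢ x F G) (precS⇓ {xs = xs} {t = t} {r = r} {y = y} D E) =
      derive x (there (here refl)) (assign y t r [] xs)
        (cong (λ l → y ∷ suc t ∷ l) (sym (evals-X y t r [] xs)))
        (via (cong (λ l → r ∷ t ∷ l) (evals-X y t r [] xs)) (complete I D)
         ∷ via (cong (λ l → y ∷ t ∷ r ∷ l) (evals-X y t r [] xs)) (complete G E) ∷ [])
    complete (muᵢ x b F) (mu⇓ {xs = xs} {y = y} D pos) =
      derive x (here refl) (assign y 0 0 [] xs) (cong (y ∷_) (sym (evals-X y 0 0 [] xs)))
        (via (cong (y ∷_) (evals-X y 0 0 [] xs)) (below y λ z z<y → _ , complete F (proj₂ (pos z z<y)))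
         ∷ via (cong (λ l → 0 ∷ y ∷ l) (evals-X y 0 0 [] xs)) (complete F D) ∷ [])
      where
        -- Unfolds the bounded quantifier of `mu⇓` into a chain of facts, one for each `z` below
        -- `y`.
        below : ∀ y → (∀ z → z < y → ∃ λ v → Derivable Γ _ (suc v ∷ z ∷ toList xs)) →
                Derivable Γ _ (y ∷ toList xs)
        below zero    _ = derive b (here refl) (assign 0 0 0 [] xs)
                            (cong (0 ∷_) (sym (evals-X 0 0 0 [] xs))) []
        below (suc y) h with h y ≤-refl
        ... | v , E = derive b (there (here refl)) (assign y v 0 [] xs)
                        (cong (suc y ∷_) (sym (evals-X y v 0 [] xs)))
                        (via (cong (y ∷_) (evals-X y v 0 [] xs)) (below y λ z z<y → h z (m≤n⇒m≤1+n z<y))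
                         ∷ via (cong (λ l → suc v ∷ y ∷ l) (evals-X y v 0 [] xs)) E ∷ [])

    complete* : ∀ {k n m} {ps : Vec (PR n) k} {xs ys} → Implements* Γ m ps → ps [ xs ]⇓* ys →
                Derivable Γ m (toList ys ++ toList xs)
    complete* (nilᵢ x) ([]⇓ {xs = xs}) =
      derive x (here refl) (assign 0 0 0 [] xs) (sym (evals-X 0 0 0 [] xs)) []
    complete* (consᵢ x F G) (_∷⇓_ {xs = xs} {y = y} {ys = ys} D Ds) =
      derive x (here refl) (assign y 0 0 ys xs) (cong (y ∷_) (sym (evals-Y++X y 0 0 ys xs)))
        (via (cong (y ∷_) (evals-X y 0 0 ys xs)) (complete F D)
         ∷ via (evals-Y++X y 0 0 ys xs) (complete* G Ds) ∷ [])

-- Soundness: closed sets of facts yield evaluations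

++-suffix : ∀ {A : Set} {as bs cs ds : List A} → length as ≡ length bs → as ++ cs ≡ bs ++ ds → cs ≡ ds
++-suffix {as = []}     {[]}     _ e = e
++-suffix {as = _ ∷ as} {_ ∷ bs} l e = ++-suffix {as = as} {bs} (suc-injective l) (proj₂ (∷-injective e))

length-X : ∀ {k n} (xs : Vec ℕ n) → length (toList xs) ≡ length (X {k} {n})
length-X {k} xs = trans (length-toList xs) (sym (length-toList (xsT {k})))

length-Y : ∀ {k n} (ys : Vec ℕ k) → length (toList ys) ≡ length (Y {k} {n})
length-Y {n = n} ys = trans (length-toList ys) (sym (length-toList (ysT {n = n})))

length-Y++X : ∀ {k n} (ys : Vec ℕ k) (xs : Vec ℕ n) →
              length (toList ys ++ toList xs) ≡ length (Y {k} {n} ++ X)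
length-Y++X {k} {n} ys xs =
  trans (length-++ (toList ys))
    (trans (cong₂ _+_ (length-Y ys) (length-X {k} xs)) (sym (length-++ (Y {k} {n}))))

module _ {Γ : Program} {M : ℕ → List ℕ → Set} (closed : Closed Γ M) where

  private
    -- The entry at an index is unique, so inverting a fact is a case analysis on the clauses stored
    -- there. The goal is a negation and thus tolerates the double negation in `Closed`.
    invert : ∀ {cs m l} → At cs m Γ → M m l →
      (∀ {c} → c ∈ cs → ∀ ρ → (length l ≡ length (head c) → l ≡ evals ρ (head c)) →
        ¬ All (λ a → M (proj₁ a) (evals ρ (proj₂ a))) (body c)) → ¬ M m l
    invert at h k _ = closed h λ { (_ , _ , ρ , at′ , c∈ , e , b) →
      k (subst (_ ∈_) (At-unique at′ at) c∈) ρ e b }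

    via : ∀ {m l l′} → l ≡ l′ → M m l → M m l′
    via refl h = h

  mutual
    -- There is no derivation to recurse on. Recursion follows the structure of the program instead,
    -- with an inner recursion on the counter in `sound-prec` and `sound-below`; every premise
    -- concerns a smaller program or a smaller counter, so endless chains of justifications do no
    -- harm.
    sound : ∀ {n m} {p : PR n} → Implements Γ m p → ∀ xs y → M m (y ∷ toList xs) → ¬ ¬ p [ xs ]⇓ y
    sound (Zᵢ x) xs y h k = invert x h (λ { (here refl) ρ e [] →
      k (subst (Z [ xs ]⇓_) (sym (proj₁ (∷-injective (e (cong suc (length-X xs)))))) zero⇓) }) h
    sound (Sᵢ x) (a ∷ []) y h k = invert x h (λ { (here refl) ρ e [] → k (claim (e refl)) }) h
      where
        claim : ∀ {v} → _≡_ {A = List ℕ} (y ∷ a ∷ []) (suc v ∷ v ∷ []) → S [ a ∷ [] ]⇓ y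
        claim refl = succ⇓
    sound (projᵢ {i = i} x) xs y h k = invert x h
      (λ { (here refl) ρ e [] → k (claim ρ (e (cong suc (length-X xs)))) }) h
      where
        claim : ∀ ρ → y ∷ toList xs ≡ evals ρ (Vec.lookup (xsT {0}) i ∷ X) → proj i [ xs ]⇓ y
        claim ρ e = subst (proj i [ xs ]⇓_) (sym same) (proj⇓ i)
          where
            open ≡-Reasoning
            same : y ≡ lookupV xs i
            same = begin
              y                                  ≡⟨ proj₁ (∷-injective e) ⟩
              eval ρ (Vec.lookup (xsT {0}) i)    ≡⟨ sym (lookup-map i (eval ρ) xsT) ⟩
              Vec.lookup (Vec.map (eval ρ) xsT) i
                ≡⟨ cong (λ v → Vec.lookup v i)
                     (trans (sym (cast-is-id refl _))
                            (toList-injective refl _ xs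
                              (trans (toList-map _ xsT) (sym (proj₂ (∷-injective e)))))) ⟩
              Vec.lookup xs i                    ≡⟨ sym (lookupV≡lookup xs i) ⟩
              lookupV xs i                       ∎
    sound (compᵢ x F G) xs y h k = invert x h (λ { (here refl) ρ e (hg ∷ hf ∷ []) →
      let e₀ , e₁ = ∷-injective (e (cong suc (length-X xs)))
          ys = Vec.map (eval ρ) ysT
          eY = sym (toList-map (eval ρ) ysT)
      in sound* G xs ys (via (trans (map-++ (eval ρ) Y X) (cong₂ _++_ eY (sym e₁))) hg) λ D →
         sound F ys y (via (cong₂ _∷_ (sym e₀) eY) hf) λ E → k (comp⇓ D E) }) h
    sound (precᵢ x F G) (t ∷ xs) y h k = sound-prec x F G t xs y h k
    sound (muᵢ x b F) xs y h k = invert x h (λ { (here refl) ρ e (hb ∷ hf ∷ []) →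
      let e₀ , e₁ = ∷-injective (e (cong suc (length-X xs)))
      in sound-below b F y xs (via (cong₂ _∷_ (sym e₀) (sym e₁)) hb) λ pos →
         sound F (y ∷ xs) 0 (via (cong₂ (λ a l → 0 ∷ a ∷ l) (sym e₀) (sym e₁)) hf) λ D →
         k (mu⇓ D pos) }) h

    sound-prec : ∀ {n m a b} {f : PR n} {g} → At (precC n m a b) m Γ →
                 Implements Γ a f → Implements Γ b g →
                 ∀ t xs y → M m (y ∷ t ∷ toList xs) → ¬ ¬ prec f g [ t ∷ xs ]⇓ y
    sound-prec x F G zero xs y h k = invert x h (λ
      { (here refl) ρ e (hf ∷ []) →
          let e₀ , e₁ = ∷-injective (e (cong (λ n → suc (suc n)) (length-X xs)))
              _  , e₂ = ∷-injective e₁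
          in sound F xs y (via (cong₂ _∷_ (sym e₀) (sym e₂)) hf) λ D → k (prec0⇓ D)
      ; (there (here refl)) ρ e _ →
          0≢1+n (proj₁ (∷-injective (proj₂ (∷-injective (e (cong (λ n → suc (suc n)) (length-X xs))))))) }) h
    sound-prec x F G (suc t) xs y h k = invert x h (λ
      { (here refl) ρ e _ →
          1+n≢0 (proj₁ (∷-injective (proj₂ (∷-injective (e (cong (λ n → suc (suc n)) (length-X xs)))))))
      ; (there (here refl)) ρ e (hp ∷ hg ∷ []) →
          let e₀ , e₁ = ∷-injective (e (cong (λ n → suc (suc n)) (length-X xs)))
              e₂ , e₃ = ∷-injective e₁
              t≡ = suc-injective e₂
              r = ρ 2
          in sound-prec x F G t xs r (via (cong₂ (λ a l → r ∷ a ∷ l) (sym t≡) (sym e₃)) hp) λ D →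
             sound G (t ∷ r ∷ xs) y
               (via (cong₂ _∷_ (sym e₀) (cong₂ (λ a l → a ∷ r ∷ l) (sym t≡) (sym e₃))) hg) λ E →
             k (precS⇓ D E) }) h

    sound-below : ∀ {n m a} {f : PR (suc n)} → At (belowC n m a) m Γ → Implements Γ a f →
                  ∀ y xs → M m (y ∷ toList xs) →
                  ¬ ¬ (∀ z → z < y → Σ ℕ λ v → f [ z ∷ xs ]⇓ suc v)
    sound-below x F zero xs h k = k λ _ ()
    sound-below x F (suc y) xs h k = invert x h (λ
      { (here refl) ρ e _ → 1+n≢0 (proj₁ (∷-injective (e (cong suc (length-X xs)))))
      ; (there (here refl)) ρ e (hb ∷ hf ∷ []) →
          let e₀ , e₁ = ∷-injective (e (cong suc (length-X xs)))
              y≡ = suc-injective e₀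
          in sound-below x F y xs (via (cong₂ _∷_ (sym y≡) (sym e₁)) hb) λ pos →
             sound F (y ∷ xs) (suc (ρ 1)) (via (cong₂ (λ a l → suc (ρ 1) ∷ a ∷ l) (sym y≡) (sym e₁)) hf) λ D →
             k λ z z<1+y → case m≤n⇒m<n∨m≡n (≤-pred z<1+y) of λ
               { (inj₁ z<y)  → pos z z<y
               ; (inj₂ refl) → _ , D } }) h

    sound* : ∀ {k n m} {ps : Vec (PR n) k} → Implements* Γ m ps →
             ∀ xs ys → M m (toList ys ++ toList xs) → ¬ ¬ ps [ xs ]⇓* ys
    sound* (nilᵢ x) xs [] h k = k []⇓
    sound* {suc j} {n} (consᵢ x F G) xs (y ∷ ys) h k = invert x h (λ { (here refl) ρ e (hf ∷ hg ∷ []) →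
      let e₀ , e₁ = ∷-injective (e (cong suc (length-Y++X ys xs)))
          -- Both sides begin with equally many outputs; cutting these off leaves the arguments.
          eX = ++-suffix (trans (length-Y {n = n} ys) (sym (length-map (eval ρ) (Y {j} {n}))))
                         (trans e₁ (map-++ (eval ρ) Y X))
      in sound F xs y (via (cong₂ _∷_ (sym e₀) (sym eX)) hf) λ D →
         sound* G xs ys (via (sym e₁) hg) λ Ds → k (D ∷⇓ Ds) }) h

-- Abbreviations in TPTL

point : ℕ → Interval
point c = interval (fin (+ c)) (fin (+ c)) true true

point-sound : ∀ {a b c} → (+ a ℤ.- + b) ∈I point c → a ≡ b + c
point-sound {a} {b} {c} (lo , hi) = ℤₚ.+-injective (begin
  + a                       ≡⟨ sym (ℤₚ.+-identityʳ (+ a)) ⟩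
  + a ℤ.+ + 0               ≡⟨ cong (ℤ._+_ (+ a)) (sym (ℤₚ.+-inverseˡ (+ b))) ⟩
  + a ℤ.+ (ℤ.- + b ℤ.+ + b) ≡⟨ sym (ℤₚ.+-assoc (+ a) (ℤ.- + b) (+ b)) ⟩
  (+ a ℤ.- + b) ℤ.+ + b     ≡⟨ cong (ℤ._+ + b) (ℤₚ.≤-antisym hi lo) ⟩
  + (c + b)                 ≡⟨ cong +_ (+-comm c b) ⟩
  + (b + c)                 ∎)
  where open ≡-Reasoning

point-complete : ∀ {a b c} → a ≡ b + c → (+ a ℤ.- + b) ∈I point c
point-complete {b = b} {c} refl = ℤₚ.≤-reflexive (sym e) , ℤₚ.≤-reflexive e
  where
    e : + (b + c) ℤ.- + b ≡ + c
    e = trans (ℤₚ.[+m]-[+n]≡m⊖n (b + c) b)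
          (trans (ℤₚ.⊖-≥ (m≤m+n b c)) (cong +_ (m+n∸m≡n b c)))

-- The syntax has no truth constants; the full interval accepts every difference and the reversed
-- one accepts none, whatever the register holds.
⊤ₜ ⊥ₜ : ∀ {k} → TPTL k
⊤ₜ = 0 ∈ᵣ interval -∞ +∞ true true
⊥ₜ = 0 ∈ᵣ interval +∞ -∞ true true

-- Until is strict: a false left argument forces the witness to be the next position, and `Fₜ` and
-- `Gₜ` exclude the present.
Xₜ Fₜ Gₜ : ∀ {k} → TPTL k → TPTL k
Xₜ φ = ⊥ₜ Uₜ φ
Fₜ φ = ⊤ₜ Uₜ φ
Gₜ φ = ¬ₜ Fₜ (¬ₜ φ)

_∨ₜ_ _⇒ₜ_ : ∀ {k} → TPTL k → TPTL k → TPTL k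
φ ∨ₜ ψ = ¬ₜ ((¬ₜ φ) ∧ₜ (¬ₜ ψ))
φ ⇒ₜ ψ = ¬ₜ (φ ∧ₜ (¬ₜ ψ))

module _ {k} {w : DataWord k} {ν : Valuation} where

  next-sound : ∀ {i} φ → w ∣ i ∣ ν ⊨ₜ Xₜ φ → w ∣ suc i ∣ ν ⊨ₜ φ
  next-sound φ (j , i<j , h , none) with m≤n⇒m<n∨m≡n i<j
  ... | inj₁ 1+i<j = ⊥-elim (proj₁ (none _ ≤-refl 1+i<j))
  ... | inj₂ refl  = h

  next-complete : ∀ {i} φ → w ∣ suc i ∣ ν ⊨ₜ φ → w ∣ i ∣ ν ⊨ₜ Xₜ φ
  next-complete φ h = _ , ≤-refl , h , λ m i<m m<1+i → ⊥-elim (<-irrefl refl (<-≤-trans i<m (≤-pred m<1+i)))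

  later : ∀ {i j} φ → i < j → w ∣ j ∣ ν ⊨ₜ φ → w ∣ i ∣ ν ⊨ₜ Fₜ φ
  later φ i<j h = _ , i<j , h , λ _ _ _ → tt , tt

-- Registers and relative positions

update-same : ∀ ν x v → update ν x v x ≡ v
update-same ν x v with x ≟ x
... | yes _ = refl
... | no ¬p = ⊥-elim (¬p refl)

update-other : ∀ ν {x} v {y} → x ≢ y → update ν x v y ≡ ν y
update-other ν {x} v {y} x≢y with x ≟ y
... | yes p = ⊥-elim (x≢y p)
... | no _  = refl

mark : TPTL 1
mark = prop Fin.zero

Marked : DataWord 1 → ℕ → Set
Marked w i = P w i Fin.zero ≡ true

-- This is addition, with the accumulator arranged so that it unfolds in step with nested next
-- operators.
adv : ℕ → ℕ → ℕ
adv zero    i = i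
adv (suc n) i = adv n (suc i)

i≤adv : ∀ n i → i ≤ adv n i
i≤adv zero    i = ≤-refl
i≤adv (suc n) i = ≤-trans (n≤1+n i) (i≤adv n (suc i))

skip : ℕ → TPTL 1 → TPTL 1
skip zero    φ = φ
skip (suc n) φ = Xₜ (skip n φ)

bindₙ : (r n : ℕ) → TPTL 1 → TPTL 1
bindₙ r zero    φ = φ
bindₙ r (suc n) φ = Xₜ (bind r (bindₙ (suc r) n φ))

module _ (w : DataWord 1) where

  skip-sound : ∀ n {i ν} φ → w ∣ i ∣ ν ⊨ₜ skip n φ → w ∣ adv n i ∣ ν ⊨ₜ φ
  skip-sound zero    φ h = h
  skip-sound (suc n) φ h = skip-sound n φ (next-sound {w = w} (skip n φ) h)

  skip-complete : ∀ n {i ν} φ → w ∣ adv n i ∣ ν ⊨ₜ φ → w ∣ i ∣ ν ⊨ₜ skip n φ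
  skip-complete zero    φ h = h
  skip-complete (suc n) φ h = next-complete {w = w} (skip n φ) (skip-complete n φ h)

  record Loaded (r n i : ℕ) (ν ν′ : Valuation) : Set where
    field
      kept   : ∀ q → q < r → ν′ q ≡ ν q
      loaded : ∀ j → j < n → ν′ (r + j) ≡ d w (suc (i + j))

  open Loaded public

  loaded-step : ∀ {r n i ν ν′} → Loaded (suc r) n (suc i) (update ν r (d w (suc i))) ν′ →
                Loaded r (suc n) i ν ν′
  loaded-step {r} {n} {i} {ν} {ν′} L = record { kept = k ; loaded = l }
    where
      k : ∀ q → q < r → ν′ q ≡ ν q
      k q q<r = trans (kept L q (m≤n⇒m≤1+n q<r)) (update-other ν {r} (d w (suc i)) (λ e → <-irrefl (sym e) q<r))
      l : ∀ j → j < suc n → ν′ (r + j) ≡ d w (suc (i + j))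
      l zero    _ rewrite +-identityʳ r | +-identityʳ i =
        trans (kept L r ≤-refl) (update-same ν r _)
      l (suc j) (s≤s j<n) rewrite +-suc r j | +-suc i j = loaded L j j<n

  bindₙ-sound : ∀ r n {i ν} φ → w ∣ i ∣ ν ⊨ₜ bindₙ r n φ →
                ∃ λ ν′ → Loaded r n i ν ν′ × w ∣ adv n i ∣ ν′ ⊨ₜ φ
  bindₙ-sound r zero    φ h = _ , record { kept = λ _ _ → refl ; loaded = λ _ () } , h
  bindₙ-sound r (suc n) φ h
    with bindₙ-sound (suc r) n φ (next-sound {w = w} (bind r (bindₙ (suc r) n φ)) h)
  ... | ν′ , L , h′ = ν′ , loaded-step L , h′

  bindₙ-complete : ∀ r n {i ν} φ → (∀ ν′ → Loaded r n i ν ν′ → w ∣ adv n i ∣ ν′ ⊨ₜ φ) →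
                   w ∣ i ∣ ν ⊨ₜ bindₙ r n φ
  bindₙ-complete r zero    φ h = h _ record { kept = λ _ _ → refl ; loaded = λ _ () }
  bindₙ-complete r (suc n) φ h =
    next-complete {w = w} (bind r (bindₙ (suc r) n φ))
      (bindₙ-complete (suc r) n φ λ ν′ L → h ν′ (loaded-step L))

-- The formula of a Horn program

size : Clause → ℕ
size c = 3 + (Clause.k c + Clause.n c)

-- A crude common bound for the number of variables of every clause. It gives all records the same
-- number of variable positions, so the arguments can be located without knowing which clause was
-- applied.
width : Program → ℕ
width Γ = sum (map (sum ∘ map size) Γ)

∈⇒≤sum : ∀ {A : Set} (f : A → ℕ) {x xs} → x ∈ xs → f x ≤ sum (map f xs)
∈⇒≤sum f (here refl) = m≤m+n _ _
∈⇒≤sum f (there x∈)  = ≤-trans (∈⇒≤sum f x∈) (m≤n+m _ _)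

At⇒∈ : ∀ {A : Set} {x : A} {n xs} → At x n xs → x ∈ xs
At⇒∈ here      = here refl
At⇒∈ (there p) = there (At⇒∈ p)

size≤width : ∀ {Γ cs m c} → At cs m Γ → c ∈ cs → size c ≤ width Γ
size≤width at c∈ = ≤-trans (∈⇒≤sum size c∈) (∈⇒≤sum (sum ∘ map size) (At⇒∈ at))

-- Register 0 holds the datum that represents the number 0, and register
-- suc i the i-th variable of a clause.

termF : ∀ {k n} → Term k n → TPTL 1
termF (num c)   = 0 ∈ᵣ point c
termF (var c i) = suc (toℕ i) ∈ᵣ point c

match : ∀ {k n} → List (Term k n) → TPTL 1 → TPTL 1
match []       φ = φ
match (t ∷ ts) φ = Xₜ (termF t ∧ₜ match ts φ)

-- A record of a fact (m , l) occupies 1 + V + length l positions: a marked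
-- one carrying m, then the variables of the clause deriving it, then l.

module _ (V : ℕ) where

  -- The premises are sought one after another, each search starting at the end of the record found
  -- before. A single forward scan suffices if they are laid out in order.
  calls : ∀ {k n} → List (ℕ × List (Term k n)) → TPTL 1
  calls []             = ⊤ₜ
  calls ((m , ts) ∷ B) = Fₜ (mark ∧ₜ ((0 ∈ᵣ point m) ∧ₜ skip V (match ts (calls B))))

  clauseF : Clause → TPTL 1
  clauseF c = bindₙ 1 V (match (head c) (calls (body c)))

  clausesF : List Clause → TPTL 1
  clausesF []       = ⊥ₜ
  clausesF (c ∷ cs) = clauseF c ∨ₜ clausesF cs

  rulesF : ℕ → Program → TPTL 1
  rulesF m []       = ⊥ₜ
  rulesF m (cs ∷ Γ) = ((0 ∈ᵣ point m) ∧ₜ clausesF cs) ∨ₜ rulesF (suc m) Γ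

module _ (w : DataWord 1) (b : ℕ) where

  Values : ℕ → List ℕ → Set
  Values i []      = ⊤
  Values i (v ∷ l) = d w (suc i) ≡ b + v × Values (suc i) l

  Values-unique : ∀ {i} l l′ → length l ≡ length l′ → Values i l → Values i l′ → l ≡ l′
  Values-unique []      []        _ _        _          = refl
  Values-unique (v ∷ l) (v′ ∷ l′) e (p , ps) (p′ , ps′) =
    cong₂ _∷_ (+-cancelˡ-≡ b v v′ (trans (sym p) p′)) (Values-unique l l′ (suc-injective e) ps ps′)

  record Env (V : ℕ) (ν : Valuation) (ρ : ℕ → ℕ) : Set where
    constructor env
    field
      base : ν 0 ≡ b
      vars : ∀ r → r < V → ν (suc r) ≡ b + ρ r

  open Env

  module _ {V ν ρ} (E : Env V ν ρ) {k n} (big : 3 + (k + n) ≤ V) where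

    private
      value : ∀ c (i : Fin (3 + (k + n))) → ν (suc (toℕ i)) + c ≡ b + (c + ρ (toℕ i))
      value c i = trans (cong (_+ c) (vars E _ (<-≤-trans (toℕ<n i) big)))
                    (trans (+-assoc b _ c) (cong (_+_ b) (+-comm _ c)))

    term-sound : ∀ {j} (t : Term k n) → w ∣ j ∣ ν ⊨ₜ termF t → d w j ≡ b + eval ρ t
    term-sound (num c)   h = trans (point-sound h) (cong (_+ c) (base E))
    term-sound (var c i) h = trans (point-sound h) (value c i)

    term-complete : ∀ {j} (t : Term k n) → d w j ≡ b + eval ρ t → w ∣ j ∣ ν ⊨ₜ termF t
    term-complete (num c)   h = point-complete (trans h (cong (_+ c) (sym (base E))))
    term-complete (var c i) h = point-complete (trans h (sym (value c i)))

    match-sound : ∀ {i} (ts : List (Term k n)) φ → w ∣ i ∣ ν ⊨ₜ match ts φ →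
                  Values i (evals ρ ts) × w ∣ adv (length ts) i ∣ ν ⊨ₜ φ
    match-sound []       φ h = tt , h
    match-sound (t ∷ ts) φ h with next-sound {w = w} (termF t ∧ₜ match ts φ) h
    ... | ht , hts with match-sound ts φ hts
    ...   | vs , h′ = (term-sound t ht , vs) , h′

    match-complete : ∀ {i} (ts : List (Term k n)) φ → Values i (evals ρ ts) →
                     w ∣ adv (length ts) i ∣ ν ⊨ₜ φ → w ∣ i ∣ ν ⊨ₜ match ts φ
    match-complete []       φ _        h = h
    match-complete (t ∷ ts) φ (v , vs) h =
      next-complete {w = w} (termF t ∧ₜ match ts φ) (term-complete t v , match-complete ts φ vs h)

-- Words satisfying the formula contain only true facts

module _ (w : DataWord 1) (b s : ℕ) (Γ : Program) (ν : Valuation) (ν₀ : ν 0 ≡ b)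
         (rules : ∀ i → s < i → w ∣ i ∣ ν ⊨ₜ (mark ⇒ₜ rulesF (width Γ) 0 Γ))
         (above : ∀ i → s < i → b ≤ d w i) where

  private V = width Γ

  -- Nothing marks the end of the arguments, so one marked position contains lists of different
  -- lengths, each a prefix of the longer ones.
  Contains : ℕ → List ℕ → Set
  Contains m l = ∃ λ i → s < i × Marked w i × d w i ≡ b + m × Values w b (adv V i) l

  calls-sound : ∀ {k n ν ρ i} → 3 + (k + n) ≤ V → Env w b V ν ρ → s ≤ i →
                (B : List (ℕ × List (Term k n))) → w ∣ i ∣ ν ⊨ₜ calls V B →
                All (λ a → Contains (proj₁ a) (evals ρ (proj₂ a))) B
  calls-sound big E s≤i [] _ = []
  calls-sound big E s≤i ((m , ts) ∷ B) (j , i<j , (mk , at , h) , _)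
    with match-sound w b E big ts (calls V B) (skip-sound w V (match ts (calls V B)) h)
  ... | vs , h′ =
        (j , s<j , mk , trans (point-sound at) (cong (_+ m) (Env.base E)) , vs)
        ∷ calls-sound big E (≤-trans (<⇒≤ s<j) (≤-trans (i≤adv V j) (i≤adv (length ts) _))) B h′
    where s<j = ≤-<-trans s≤i i<j

  clausesF-sound : ∀ {i} cs → w ∣ i ∣ ν ⊨ₜ clausesF V cs →
                   ¬ ¬ (∃ λ c → c ∈ cs × w ∣ i ∣ ν ⊨ₜ clauseF V c)
  clausesF-sound (c ∷ cs) h k =
    h ((λ hc → k (c , here refl , hc)) ,
       (λ hcs → clausesF-sound cs hcs λ { (c′ , c∈ , h′) → k (c′ , there c∈ , h′) }))

  rulesF-sound : ∀ {i} m₀ Δ → w ∣ i ∣ ν ⊨ₜ rulesF V m₀ Δ →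
                 ¬ ¬ (∃ λ m → ∃ λ cs → d w i ≡ b + (m₀ + m) × At cs m Δ × w ∣ i ∣ ν ⊨ₜ clausesF V cs)
  rulesF-sound {i} m₀ (cs ∷ Δ) h k =
    h ((λ { (at , hcs) → k (0 , cs , trans (point-sound at) (cong₂ _+_ ν₀ (sym (+-identityʳ m₀))) , here , hcs) }) ,
       (λ h′ → rulesF-sound (suc m₀) Δ h′ λ { (m , cs′ , e , at , hcs) →
          k (suc m , cs′ , trans e (cong (_+_ b) (sym (+-suc m₀ m))) , there at , hcs) }))

  contains-closed : Closed Γ Contains
  contains-closed {m} {l} (i , s<i , mk , dm , vs) k =
    rules i s<i (mk , λ hr →
    rulesF-sound 0 Γ hr λ { (m′ , cs , dm′ , at , hcs) →
    clausesF-sound cs hcs λ { (c , c∈ , hc) →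
    finish (+-cancelˡ-≡ b m m′ (trans (sym dm) dm′)) at c∈ hc } })
    where
      ρ : ℕ → ℕ
      -- The truncated subtraction is exact, because `above` keeps all data after `s` at or over the
      -- zero point `b`.
      ρ r = d w (suc (i + r)) ∸ b

      finish : ∀ {m′ cs c} → m ≡ m′ → At cs m′ Γ → c ∈ cs → ¬ (w ∣ i ∣ ν ⊨ₜ clauseF V c)
      finish {c = c} refl at c∈ hc with bindₙ-sound w 1 V (match (head c) (calls V (body c))) hc
      ... | ν′ , L , h = k (_ , c , ρ , at , c∈ ,
              (λ e → Values-unique w b l _ (trans e (sym (length-map (eval ρ) (head c)))) vs (proj₁ r)) ,
              calls-sound big E
                (≤-trans (<⇒≤ s<i) (≤-trans (i≤adv V i) (i≤adv (length (head c)) _))) (body c) (proj₂ r))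
        where
          big = size≤width at c∈
          E : Env w b V ν′ ρ
          E = env (trans (kept L 0 (s≤s z≤n)) ν₀)
                  (λ r r<V → trans (loaded L r r<V)
                    (sym (m+[n∸m]≡n (above _ (<-≤-trans s<i (m≤n⇒m≤1+n (m≤m+n i r)))))))
          r = match-sound w b E big (head c) (calls V (body c)) h

-- Derivations yield words satisfying the formula

Record : Set
Record = ℕ × List ℕ × (ℕ → ℕ)

-- The premises occur as a subsequence of the records, in the order in which `calls` looks for them.
data Sub : List (ℕ × List ℕ) → List Record → Set where
  done : ∀ {L} → Sub [] L
  drop : ∀ {A r L} → Sub A L → Sub A (r ∷ L)
  keep : ∀ {m l ρ A L} → Sub A L → Sub ((m , l) ∷ A) ((m , l , ρ) ∷ L)

Sub-++ʳ : ∀ {A L} L′ → Sub A L → Sub A (L ++ L′)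
Sub-++ʳ L′ done     = done
Sub-++ʳ L′ (drop p) = drop (Sub-++ʳ L′ p)
Sub-++ʳ L′ (keep p) = keep (Sub-++ʳ L′ p)

Sub-++ˡ : ∀ {A L} L′ → Sub A L → Sub A (L′ ++ L)
Sub-++ˡ []       p = p
Sub-++ˡ (_ ∷ L′) p = drop (Sub-++ˡ L′ p)

instances : ∀ {k n} → (ℕ → ℕ) → List (ℕ × List (Term k n)) → List (ℕ × List ℕ)
instances ρ = map (λ a → proj₁ a , evals ρ (proj₂ a))

data Justified (Γ : Program) : List Record → Set where
  []  : Justified Γ []
  add : ∀ {m cs c ρ L} → At cs m Γ → c ∈ cs → Sub (instances ρ (body c)) L →
        Justified Γ L → Justified Γ ((m , evals ρ (head c) , ρ) ∷ L)

Justified-++ : ∀ {Γ L L′} → Justified Γ L → Justified Γ L′ → Justified Γ (L ++ L′)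
Justified-++ []               J′ = J′
Justified-++ (add at c∈ s J) J′ = add at c∈ (Sub-++ʳ _ s) (Justified-++ J J′)

module _ {Γ : Program} where
  mutual
    -- Listing a derivation tree in preorder puts each fact before its premises and keeps the
    -- premises in order, with their own subtrees in between.
    preorder : ∀ {m l} → Derivable Γ m l → ∃ λ ρ → ∃ λ L → Justified Γ ((m , l , ρ) ∷ L)
    preorder (derive at c∈ ρ refl Ds) with preorder* ρ _ Ds
    ... | L , s , J = ρ , L , add at c∈ s J

    preorder* : ∀ {k n} ρ (B : List (ℕ × List (Term k n))) →
                All (λ a → Derivable Γ (proj₁ a) (evals ρ (proj₂ a))) B →
                ∃ λ L → Sub (instances ρ B) L × Justified Γ L
    preorder* ρ []      []       = [] , done , []
    preorder* ρ (_ ∷ B) (D ∷ Ds) with preorder D | preorder* ρ B Ds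
    ... | _ , L , J | L′ , s , J′ = _ , keep (Sub-++ˡ L s) , Justified-++ J J′

Cell : Set
Cell = Bool × ℕ

cell : DataWord 1 → ℕ → Cell
cell w i = P w i Fin.zero , d w i

-- Beyond the listed cells only marks are forbidden, since unmarked positions satisfy the rules
-- trivially.
Reads : DataWord 1 → ℕ → List Cell → Set
Reads w i []       = ∀ j → i ≤ j → P w j Fin.zero ≡ false
Reads w i (c ∷ cs) = cell w i ≡ c × Reads w (suc i) cs

module _ (V : ℕ) where

  cells : List Record → List Cell
  cells []                = []
  cells ((m , l , ρ) ∷ L) = (true , m) ∷ map (false ,_) (applyUpTo ρ V) ++ map (false ,_) l ++ cells L

module _ (w : DataWord 1) where

  Unmarked : ℕ → ℕ → Set
  Unmarked i j = ∀ k → i < k → k ≤ j → P w k Fin.zero ≡ false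

  read-values : ∀ {i} l {cs} → Reads w (suc i) (map (false ,_) l ++ cs) →
                Values w 0 i l × Unmarked i (adv (length l) i) × Reads w (suc (adv (length l) i)) cs
  read-values []      R = tt , (λ k i<k k≤i → ⊥-elim (<-irrefl refl (<-≤-trans i<k k≤i))) , R
  read-values {i} (v ∷ l) (e , R) with read-values l R
  ... | vs , U , R′ = (cong proj₂ e , vs) , U′ , R′
    where
      U′ : Unmarked i (adv (length l) (suc i))
      U′ k i<k k≤ with m≤n⇒m<n∨m≡n i<k
      ... | inj₁ lt   = U k lt k≤
      ... | inj₂ refl = cong proj₁ e

  read-vars : ∀ n {i} (ρ : ℕ → ℕ) {cs} → Reads w (suc i) (map (false ,_) (applyUpTo ρ n) ++ cs) →
              (∀ r → r < n → d w (suc (i + r)) ≡ ρ r) × Unmarked i (adv n i) × Reads w (suc (adv n i)) cs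
  read-vars zero    ρ R = (λ _ ()) , (λ k i<k k≤i → ⊥-elim (<-irrefl refl (<-≤-trans i<k k≤i))) , R
  read-vars (suc n) {i} ρ (e , R) with read-vars n (ρ ∘ suc) R
  ... | vs , U , R′ = vs′ , U′ , R′
    where
      vs′ : ∀ r → r < suc n → d w (suc (i + r)) ≡ ρ r
      vs′ zero    _         rewrite +-identityʳ i = cong proj₂ e
      vs′ (suc r) (s≤s r<n) rewrite +-suc i r = vs r r<n
      U′ : Unmarked i (adv n (suc i))
      U′ k i<k k≤ with m≤n⇒m<n∨m≡n i<k
      ... | inj₁ lt   = U k lt k≤
      ... | inj₂ refl = cong proj₁ e

  module _ (V : ℕ) where

    record ReadsRecord (i : ℕ) (r : Record) (L : List Record) : Set where
      private
        m = proj₁ r ; l = proj₁ (proj₂ r) ; ρ = proj₂ (proj₂ r)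
        end = adv (length l) (adv V i)
      field
        marked   : Marked w i
        name     : d w i ≡ m
        varsAt   : ∀ r → r < V → d w (suc (i + r)) ≡ ρ r
        argsAt   : Values w 0 (adv V i) l
        unmarked : Unmarked i end
        rest     : Reads w (suc end) (cells V L)

    open ReadsRecord

    read-record : ∀ {i} r L → Reads w i (cells V (r ∷ L)) → ReadsRecord i r L
    read-record {i} (m , l , ρ) L (e , R) with read-vars V ρ R
    ... | vs , U , R′ with read-values l R′
    ...   | as , U′ , R″ = record
      { marked = cong proj₁ e ; name = cong proj₂ e ; varsAt = vs ; argsAt = as ; rest = R″
      ; unmarked = λ k i<k k≤ → case-≤ k i<k k≤ }
      where
        case-≤ : Unmarked i (adv (length l) (adv V i))
        case-≤ k i<k k≤ with ≤-<-connex k (adv V i)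
        ... | inj₁ k≤V = U k i<k k≤V
        ... | inj₂ V<k = U′ k V<k k≤

    -- The searching position `i` may lag behind the reading position `j`; a record dropped by `Sub`
    -- is passed over by moving `j` alone.
    calls-complete : ∀ {k n ν ρ i j L} → 3 + (k + n) ≤ V → Env w 0 V ν ρ → i < j →
                     (B : List (ℕ × List (Term k n))) → Sub (instances ρ B) L →
                     Reads w j (cells V L) → w ∣ i ∣ ν ⊨ₜ calls V B
    calls-complete big E i<j [] _ R = tt , tt
    calls-complete {L = r ∷ L} big E i<j B@(_ ∷ _) (drop s) R =
      calls-complete big E
        (<-≤-trans i<j (m≤n⇒m≤1+n (≤-trans (i≤adv V _) (i≤adv (length (proj₁ (proj₂ r))) _)))) B s
        (rest (read-record r L R))
    calls-complete {ρ = ρ} {L = r ∷ L} big E i<j ((m , ts) ∷ B) (keep s) R =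
      later {w = w} (mark ∧ₜ ((0 ∈ᵣ point m) ∧ₜ skip V (match ts (calls V B)))) i<j
        ( marked rr
        , point-complete (trans (name rr) (cong (_+ m) (sym (Env.base E))))
        , skip-complete w V (match ts (calls V B))
            (match-complete w 0 E big ts (calls V B) (argsAt rr)
              (calls-complete big E
                (s≤s (≤-reflexive (cong (λ n → adv n _) (sym (length-map (eval ρ) ts))))) B s (rest rr))) )
      where rr = read-record r L R

    clausesF-complete : ∀ {i ν c cs} → c ∈ cs → w ∣ i ∣ ν ⊨ₜ clauseF V c → w ∣ i ∣ ν ⊨ₜ clausesF V cs
    clausesF-complete (here refl) h (¬c , _)  = ¬c h
    clausesF-complete (there c∈)  h (_ , ¬cs) = ¬cs (clausesF-complete c∈ h)

    rulesF-complete : ∀ {i ν cs m Γ} → ν 0 ≡ 0 → At cs m Γ → ∀ m₀ → d w i ≡ m₀ + m →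
                      w ∣ i ∣ ν ⊨ₜ clausesF V cs → w ∣ i ∣ ν ⊨ₜ rulesF V m₀ Γ
    rulesF-complete ν₀ here m₀ e h (¬here , _) =
      ¬here (point-complete (trans e (trans (+-identityʳ m₀) (cong (_+ m₀) (sym ν₀)))) , h)
    rulesF-complete {m = suc m} ν₀ (there at) m₀ e h (_ , ¬there) =
      ¬there (rulesF-complete ν₀ at (suc m₀) (trans e (+-suc m₀ m)) h)

    clauseF-complete : ∀ {i ν c m ρ L} → ν 0 ≡ 0 → size c ≤ V → Sub (instances ρ (body c)) L →
                       ReadsRecord i (m , evals ρ (head c) , ρ) L → w ∣ i ∣ ν ⊨ₜ clauseF V c
    clauseF-complete {i} {ν} {c} {ρ = ρ} ν₀ big s rr =
      bindₙ-complete w 1 V (match (head c) (calls V (body c))) λ ν′ L →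
        let E = env (trans (kept L 0 (s≤s z≤n)) ν₀) (λ r r<V → trans (loaded L r r<V) (varsAt rr r r<V))
        in match-complete w 0 E big (head c) (calls V (body c)) (argsAt rr)
             (calls-complete big E
               (s≤s (≤-reflexive (cong (λ n → adv n _) (sym (length-map (eval ρ) (head c)))))) (body c) s (rest rr))

  -- A position carries the mark of the first record, lies in its unmarked interior, or belongs to
  -- the remaining records.
  rules-complete : ∀ {Γ L i ν} → ν 0 ≡ 0 → Justified Γ L → Reads w i (cells (width Γ) L) →
                   ∀ j → i ≤ j → w ∣ j ∣ ν ⊨ₜ (mark ⇒ₜ rulesF (width Γ) 0 Γ)
  rules-complete ν₀ [] R j i≤j (mk , _) with trans (sym mk) (R j i≤j)
  ... | ()
  rules-complete {Γ} {r ∷ L} {i} ν₀ (add at c∈ s J) R j i≤j (mk , ¬rules) with m≤n⇒m<n∨m≡n i≤j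
  ... | inj₂ refl = ¬rules (rulesF-complete (width Γ) ν₀ at 0 (ReadsRecord.name rr)
                      (clausesF-complete (width Γ) c∈
                        (clauseF-complete (width Γ) ν₀ (size≤width at c∈) s rr)))
    where rr = read-record (width Γ) r L R
  ... | inj₁ i<j with ≤-<-connex j (adv (length (proj₁ (proj₂ r))) (adv (width Γ) i))
  ...   | inj₂ end<j = rules-complete ν₀ J (ReadsRecord.rest (read-record (width Γ) r L R)) j end<j (mk , ¬rules)
  ...   | inj₁ j≤end with trans (sym mk) (ReadsRecord.unmarked (read-record (width Γ) r L R) j i<j j≤end)
  ...     | ()

-- The formula simulating a program

module _ (V m : ℕ) where

  -- Register 1 holds the input datum, stored by `acceptF`. The input is thus read from the word and
  -- does not occur in the formula.
  outputF : TPTL 1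
  outputF = Xₜ ((0 ∈ᵣ point 1) ∧ₜ Xₜ (1 ∈ᵣ point 0))

  foundF : TPTL 1
  foundF = mark ∧ₜ ((0 ∈ᵣ point m) ∧ₜ skip V outputF)

  acceptF : TPTL 1
  acceptF = Xₜ (bind 1 (Fₜ foundF))

nonNegative : Interval
nonNegative = interval (fin (+ 0)) +∞ true true

-- Every mark is justified, no later datum lies below the zero point in register 0, and some record
-- claims output 1 on the input.
machineF : Program → ℕ → TPTL 1
machineF Γ m = Gₜ (mark ⇒ₜ rulesF (width Γ) 0 Γ) ∧ₜ (Gₜ (0 ∈ᵣ nonNegative) ∧ₜ acceptF (width Γ) m)

runF : TPTL 1 → ℕ → TPTL 1
runF R x = bind 0 (R ∧ₜ Xₜ (0 ∈ᵣ point x))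

run-sound : ∀ {w i ν Γ m p x} → Implements Γ m p → w ∣ i ∣ ν ⊨ₜ runF (machineF Γ m) x →
            ¬ ¬ p [ x ∷ [] ]⇓ 1
run-sound {w} {i} {ν} {Γ} {m} {p} {x} I ((G₁ , G₂ , acc) , inp) =
  sound (contains-closed w b i Γ ν′ refl rules above) I (x ∷ []) 1 found
  where
    b = d w i
    ν′ = update ν 0 b
    ν″ = update ν′ 1 (d w (suc i))
    V = width Γ
    rules : ∀ j → i < j → w ∣ j ∣ ν′ ⊨ₜ (mark ⇒ₜ rulesF V 0 Γ)
    rules j i<j h = G₁ (later {w = w} (¬ₜ (mark ⇒ₜ rulesF V 0 Γ)) i<j (λ f → f h))
    above : ∀ j → i < j → b ≤ d w j
    above j i<j = decidable-stable (b ≤? d w j) λ b≰d →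
      G₂ (later {w = w} {ν = ν′} (¬ₜ (0 ∈ᵣ nonNegative)) i<j
            λ { (0≤ , _) → b≰d (ℤₚ.drop‿+≤+ (ℤₚ.0≤i-j⇒j≤i 0≤)) })
    input : d w (suc i) ≡ b + x
    input = point-sound {b = b} (next-sound {w = w} {ν = ν′} (0 ∈ᵣ point x) inp)
    found : Contains w b i Γ ν′ refl rules above m (1 ∷ x ∷ [])
    found with next-sound {w = w} {ν = ν′} (bind 1 (Fₜ (foundF V m))) acc
    ... | j , 1+i<j , (mk , at , h) , _
        with next-sound {w = w} {ν = ν″} ((0 ∈ᵣ point 1) ∧ₜ Xₜ (1 ∈ᵣ point 0)) (skip-sound w V (outputF V m) h)
    ...   | one , h′ =
        j , <-trans ≤-refl 1+i<j , mk , point-sound {b = b} at , point-sound {b = b} one ,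
        trans (point-sound {b = d w (suc i)} (next-sound {w = w} {ν = ν″} (1 ∈ᵣ point 0) h′))
              (trans (+-identityʳ _) input) ,
        tt

run-complete : ∀ {Γ m p x} → Implements Γ m p → p [ x ∷ [] ]⇓ 1 →
               ∃ λ cs → ∀ w i ν → Reads w i cs → w ∣ i ∣ ν ⊨ₜ runF (machineF Γ m) x
run-complete {Γ} {m} {p} {x} I D with preorder (complete I D)
-- The first two cells are the zero point and the input. With 0 as zero point the nonnegativity
-- conjunct is automatic.
... | ρ , L , J = (false , 0) ∷ (false , x) ∷ cells V ((m , 1 ∷ x ∷ [] , ρ) ∷ L) , holds
  where
    V = width Γ
    holds : ∀ w i ν → Reads w i ((false , 0) ∷ (false , x) ∷ cells V ((m , 1 ∷ x ∷ [] , ρ) ∷ L)) →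
            w ∣ i ∣ ν ⊨ₜ runF (machineF Γ m) x
    holds w i ν (e₀ , e₁ , R) =
      (G₁ , G₂ , acc) ,
      next-complete {w = w} {ν = update ν 0 (d w i)} (0 ∈ᵣ point x) (point-complete {b = d w i} input)
      where
        b = d w i
        b≡0 : b ≡ 0
        b≡0 = cong proj₂ e₀
        ν′ = update ν 0 b
        ν″ = update ν′ 1 (d w (suc i))
        rr = read-record w V (m , 1 ∷ x ∷ [] , ρ) L R
        input : d w (suc i) ≡ b + x
        input = trans (cong proj₂ e₁) (cong (_+ x) (sym b≡0))
        G₁ : w ∣ i ∣ ν′ ⊨ₜ Gₜ (mark ⇒ₜ rulesF V 0 Γ)
        G₁ (j , i<j , ¬rule , _) with m≤n⇒m<n∨m≡n i<j
        ... | inj₁ 1+i<j = ¬rule (rules-complete w b≡0 J R j 1+i<j)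
        ... | inj₂ refl  = ¬rule λ { (mk , _) → true≢false (trans (sym mk) (cong proj₁ e₁)) }
        G₂ : w ∣ i ∣ ν′ ⊨ₜ Gₜ (0 ∈ᵣ nonNegative)
        G₂ (j , _ , h , _) = h (ℤₚ.i≤j⇒0≤j-i (ℤ.+≤+ (subst (_≤ d w j) (sym b≡0) z≤n)) , tt)
        args = ReadsRecord.argsAt rr
        acc : w ∣ i ∣ ν′ ⊨ₜ acceptF V m
        acc = next-complete {w = w} (bind 1 (Fₜ (foundF V m)))
          (later {w = w} (foundF V m) ≤-refl
            ( ReadsRecord.marked rr
            , point-complete {b = b} (trans (ReadsRecord.name rr) (cong (_+ m) (sym b≡0)))
            , skip-complete w V (outputF V m)
                (next-complete {w = w} {ν = ν″} ((0 ∈ᵣ point 1) ∧ₜ Xₜ (1 ∈ᵣ point 0))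
                  ( point-complete {b = b} (trans (proj₁ args) (cong (_+ 1) (sym b≡0)))
                  , next-complete {w = w} {ν = ν″} (1 ∈ᵣ point 0)
                      (point-complete {b = d w (suc i)} (trans (proj₁ (proj₂ args))
                        (sym (trans (+-identityʳ _) (cong proj₂ e₁))))) )) ))

-- Data far away from all constants

-- The successor makes all comparisons with a finite endpoint strict, so open and closed endpoints
-- behave alike at a distance.
boundOf : Bound → ℕ
boundOf -∞      = 0
boundOf +∞      = 0
boundOf (fin c) = suc ℤ.∣ c ∣

constants : Interval → ℕ
constants I = boundOf (Interval.lo I) + boundOf (Interval.hi I)

<1+∣∣ : ∀ c → c ℤ.< + suc ℤ.∣ c ∣
<1+∣∣ (+ n)    = ℤ.+<+ ≤-refl
<1+∣∣ -[1+ n ] = ℤ.-<+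

-1+∣∣< : ∀ c → ℤ.- (+ suc ℤ.∣ c ∣) ℤ.< c
-1+∣∣< (+ n)    = ℤ.-<+
-1+∣∣< -[1+ n ] = ℤ.-<- ≤-refl

module _ {G : ℕ} where

  far-above : ∀ {I z z′} → constants I ≤ G → + G ℤ.≤ z → + G ℤ.≤ z′ → z ∈I I → z′ ∈I I
  far-above {interval lo hi lc hc} {z} {z′} small G≤z G≤z′ (l , h) =
    lower lo lc (≤-trans (m≤m+n _ _) small) l , upper hi hc (≤-trans (m≤n+m _ _) small) h
    where
      below : ∀ c → suc ℤ.∣ c ∣ ≤ G → c ℤ.< + G
      below c s = ℤₚ.<-≤-trans (<1+∣∣ c) (ℤ.+≤+ s)
      lower : ∀ b c → boundOf b ≤ G → lowerOK b c z → lowerOK b c z′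
      lower -∞      _     _ _ = tt
      lower (fin c) true  s _ = ℤₚ.<⇒≤ (ℤₚ.<-≤-trans (below c s) G≤z′)
      lower (fin c) false s _ = ℤₚ.<-≤-trans (below c s) G≤z′
      upper : ∀ b c → boundOf b ≤ G → upperOK b c z → upperOK b c z′
      upper +∞      _     _ _ = tt
      upper (fin c) true  s h = contradiction (ℤₚ.<-≤-trans (below c s) (ℤₚ.≤-trans G≤z h)) (ℤₚ.<-irrefl refl)
      upper (fin c) false s h = contradiction (ℤₚ.<-≤-trans (below c s) (ℤₚ.≤-trans G≤z (ℤₚ.<⇒≤ h))) (ℤₚ.<-irrefl refl)

  far-below : ∀ {I z z′} → constants I ≤ G → z ℤ.≤ ℤ.- (+ G) → z′ ℤ.≤ ℤ.- (+ G) → z ∈I I → z′ ∈I I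
  far-below {interval lo hi lc hc} {z} {z′} small z≤G z′≤G (l , h) =
    lower lo lc (≤-trans (m≤m+n _ _) small) l , upper hi hc (≤-trans (m≤n+m _ _) small) h
    where
      above : ∀ c → suc ℤ.∣ c ∣ ≤ G → ℤ.- (+ G) ℤ.< c
      above c s = ℤₚ.≤-<-trans (ℤₚ.neg-mono-≤ (ℤ.+≤+ s)) (-1+∣∣< c)
      lower : ∀ b c → boundOf b ≤ G → lowerOK b c z → lowerOK b c z′
      lower -∞      _     _ _ = tt
      lower (fin c) true  s l = contradiction (ℤₚ.≤-<-trans (ℤₚ.≤-trans l z≤G) (above c s)) (ℤₚ.<-irrefl refl)
      lower (fin c) false s l = contradiction (ℤₚ.≤-<-trans (ℤₚ.≤-trans (ℤₚ.<⇒≤ l) z≤G) (above c s)) (ℤₚ.<-irrefl refl)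
      upper : ∀ b c → boundOf b ≤ G → upperOK b c z → upperOK b c z′
      upper +∞      _     _ _ = tt
      upper (fin c) true  s _ = ℤₚ.<⇒≤ (ℤₚ.≤-<-trans z′≤G (above c s))
      upper (fin c) false s _ = ℤₚ.≤-<-trans z′≤G (above c s)

a+G≤b⇒G≤b-a : ∀ a b G → a + G ≤ b → + G ℤ.≤ + b ℤ.- + a
a+G≤b⇒G≤b-a a b G le = subst (+ G ℤ.≤_)
  (sym (trans (ℤₚ.[+m]-[+n]≡m⊖n b a) (ℤₚ.⊖-≥ (≤-trans (m≤m+n a G) le))))
  (ℤ.+≤+ (m+n≤o⇒m≤o∸n G (subst (_≤ b) (+-comm a G) le)))

b+G≤a⇒b-a≤-G : ∀ a b G → b + G ≤ a → + b ℤ.- + a ℤ.≤ ℤ.- (+ G)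
b+G≤a⇒b-a≤-G a b G le = subst (ℤ._≤ ℤ.- (+ G))
  (trans (cong (ℤ.-_) (ℤₚ.[+m]-[+n]≡m⊖n a b))
         (trans (sym (ℤₚ.⊖-swap b a)) (sym (ℤₚ.[+m]-[+n]≡m⊖n b a))))
  (ℤₚ.neg-mono-≤ (a+G≤b⇒G≤b-a b a G le))

a<b⇒0<b-a : ∀ {a b} → a < b → + 0 ℤ.< + b ℤ.- + a
a<b⇒0<b-a {a} {b} lt =
  ℤₚ.<-≤-trans (ℤ.+<+ ≤-refl) (a+G≤b⇒G≤b-a a b 1 (subst (_≤ b) (+-comm 1 a) lt))

a<b⇒a-b<0 : ∀ {a b} → a < b → + a ℤ.- + b ℤ.< + 0
a<b⇒a-b<0 {a} {b} lt =
  ℤₚ.≤-<-trans (b+G≤a⇒b-a≤-G b a 1 (subst (_≤ b) (+-comm 1 a) lt)) ℤ.-<+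

0<b-a⇒a<b : ∀ {a b} → + 0 ℤ.< + b ℤ.- + a → a < b
0<b-a⇒a<b lt = ≰⇒> λ b≤a → ℤₚ.<-irrefl refl (ℤₚ.<-≤-trans lt (ℤₚ.i≤j⇒i-j≤0 (ℤ.+≤+ b≤a)))

a-b<0⇒a<b : ∀ {a b} → + a ℤ.- + b ℤ.< + 0 → a < b
a-b<0⇒a<b lt = ≰⇒> λ b≤a → ℤₚ.<-irrefl refl (ℤₚ.≤-<-trans (ℤₚ.i≤j⇒0≤j-i (ℤ.+≤+ b≤a)) lt)

-- Truth at position 0 as a function of the first datum

word : ℕ → (ℕ → Cell) → DataWord 1
word a t = record { P = P′ ; d = d′ }
  where
    P′ : ℕ → Fin 1 → Bool
    P′ zero    _ = false
    P′ (suc i) _ = proj₁ (t i)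
    d′ : ℕ → ℕ
    d′ zero    = a
    d′ (suc i) = proj₂ (t i)

-- Until only looks to the right, so the first datum is invisible from all later positions.
transfer : ∀ {a a′ t} ψ i → word a t ∣ suc i ⊨ₘ ψ → word a′ t ∣ suc i ⊨ₘ ψ
transfer (prop p)     i h         = h
transfer (¬ₘ ψ)       i h         = h ∘ transfer ψ i
transfer (φ ∧ₘ ψ)     i (h , h′)  = transfer φ i h , transfer ψ i h′
transfer {a} {a′} {t} (φ U[ I ] ψ) i (suc j , i<j , h , e , g) =
  suc j , i<j , transfer ψ j h , e , between
  where
    between : ∀ m → suc i < m → m < suc j → word a′ t ∣ m ⊨ₘ φ
    between (suc m) i<m m<j = transfer φ m (g (suc m) i<m m<j)

-- Counting the changes of an MTL formula

module _ (U : ℕ → Set) where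

  -- A monotone predicate changes at most once. If `U N` holds, the step after `N` is no change;
  -- otherwise `U` fails up to `N`, and only that step can be one. As `U` need not be decidable, the
  -- case distinction is made under a double negation.
  increasing-change : (∀ ℓ → U ℓ → U (suc ℓ)) → ∀ N →
                      ¬ ¬ (∃ λ c → ∀ ℓ → ℓ < N → ℓ ≢ c → U (suc ℓ) → U ℓ)
  increasing-change up zero k = k (0 , λ _ ())
  increasing-change up (suc N) k = ¬¬-excluded-middle {A = U N} λ
    { (yes u) → increasing-change up N λ { (c , h) →
        k (c , λ ℓ ℓ<1+N ℓ≢c u′ →
             step u (m≤n⇒m<n∨m≡n (≤-pred ℓ<1+N)) (λ ℓ<N → h ℓ ℓ<N ℓ≢c u′)) }
    ; (no ¬u) → k (N , λ ℓ ℓ<1+N ℓ≢N u′ → ⊥-elim (¬u (climb u′ (≤∧≢⇒< (≤-pred ℓ<1+N) ℓ≢N)))) }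
    where
      step : ∀ {ℓ} → U N → ℓ < N ⊎ ℓ ≡ N → (ℓ < N → U ℓ) → U ℓ
      step u (inj₁ ℓ<N)  f = f ℓ<N
      step u (inj₂ refl) f = u
      climb′ : ∀ {i} n → U i → U (n + i)
      climb′ zero    u = u
      climb′ (suc n) u = up _ (climb′ n u)
      climb : ∀ {i j} → U i → i ≤ j → U j
      climb {i} {j} u i≤j = subst U (m∸n+n≡m i≤j) (climb′ (j ∸ i) u)

  decreasing-change : (∀ ℓ → U (suc ℓ) → U ℓ) → ∀ N →
                      ¬ ¬ (∃ λ c → ∀ ℓ → ℓ < N → ℓ ≢ c → U ℓ → U (suc ℓ))
  decreasing-change down zero k = k (0 , λ _ ())
  decreasing-change down (suc N) k = ¬¬-excluded-middle {A = U N} λ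
    { (yes u) → k (N , λ ℓ ℓ<1+N ℓ≢N _ → descend u (≤∧≢⇒< (≤-pred ℓ<1+N) ℓ≢N))
    ; (no ¬u) → decreasing-change down N λ { (c , h) →
        k (c , λ ℓ ℓ<1+N ℓ≢c u′ →
             step ¬u u′ (m≤n⇒m<n∨m≡n (≤-pred ℓ<1+N)) (λ ℓ<N → h ℓ ℓ<N ℓ≢c u′)) } }
    where
      step : ∀ {ℓ} → ¬ U N → U ℓ → ℓ < N ⊎ ℓ ≡ N → (ℓ < N → U (suc ℓ)) → U (suc ℓ)
      step ¬u u (inj₁ ℓ<N)  f = f ℓ<N
      step ¬u u (inj₂ refl) f = ⊥-elim (¬u u)
      descend′ : ∀ {i} n → U (n + i) → U i
      descend′ zero    u = u
      descend′ (suc n) u = descend′ n (down _ u)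
      descend : ∀ {i j} → U j → i ≤ j → U i
      descend {i} {j} u i≤j = descend′ (j ∸ i) (subst U (sym (m∸n+n≡m i≤j)) u)

-- Only the untils outside the scope of other untils depend on the first datum.

outer : MTL 1 → ℕ
outer (prop p)     = 0
outer (¬ₘ ψ)       = outer ψ
outer (φ ∧ₘ ψ)     = outer φ + outer ψ
outer (φ U[ I ] ψ) = 2

outerConstants : MTL 1 → ℕ
outerConstants (prop p)     = 0
outerConstants (¬ₘ ψ)       = outerConstants ψ
outerConstants (φ ∧ₘ ψ)     = outerConstants φ + outerConstants ψ
outerConstants (φ U[ I ] ψ) = constants I

module _ {t : ℕ → Cell} {G : ℕ} (a : ℕ → ℕ) (a-mono : ∀ ℓ → a ℓ ≤ a (suc ℓ))
         (far : ∀ ℓ j → a ℓ + G ≤ proj₂ (t j) ⊎ proj₂ (t j) + G ≤ a ℓ) where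

  Agree : MTL 1 → ℕ → Set
  Agree ψ ℓ = (word (a ℓ) t ⊨ₘ ψ → word (a (suc ℓ)) t ⊨ₘ ψ) ×
              (word (a (suc ℓ)) t ⊨ₘ ψ → word (a ℓ) t ⊨ₘ ψ)

  module _ (φ ψ : MTL 1) (I : Interval) where

    -- The first datum 0 is an arbitrary choice, justified by `transfer`: the candidates are the
    -- same for every `ℓ`.
    Candidate : ℕ → Set
    Candidate j = word 0 t ∣ suc j ⊨ₘ ψ × (∀ m → m < j → word 0 t ∣ suc m ⊨ₘ φ)

    Above Below : ℕ → Set
    Above ℓ = ∃ λ j → Candidate j × a ℓ + G ≤ proj₂ (t j)
    Below ℓ = ∃ λ j → Candidate j × proj₂ (t j) + G ≤ a ℓ

    module _ (small : constants I ≤ G) where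

      -- Later data differ from the first one by at least `G`, beyond the constants of `I`. Only the
      -- side on which they lie matters, and `G` or its negative can stand for the difference.
      split : ∀ ℓ → word (a ℓ) t ⊨ₘ (φ U[ I ] ψ) →
              ((+ G) ∈I I × Above ℓ) ⊎ ((ℤ.- (+ G)) ∈I I × Below ℓ)
      split ℓ (suc j , _ , h , e , g) with far ℓ j
      ... | inj₁ le = inj₁ (far-above {I = I} small (a+G≤b⇒G≤b-a (a ℓ) _ G le) ℤₚ.≤-refl e ,
                            j , (transfer ψ j h , λ m m<j → transfer φ m (g (suc m) (s≤s z≤n) (s≤s m<j))) , le)
      ... | inj₂ le = inj₂ (far-below {I = I} small (b+G≤a⇒b-a≤-G (a ℓ) _ G le) ℤₚ.≤-refl e ,
                            j , (transfer ψ j h , λ m m<j → transfer φ m (g (suc m) (s≤s z≤n) (s≤s m<j))) , le)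

      between : ∀ {b j} → (∀ m → m < j → word 0 t ∣ suc m ⊨ₘ φ) →
                ∀ m → 0 < m → m < suc j → word b t ∣ m ⊨ₘ φ
      between g (suc m) _ (s≤s m<j) = transfer φ m (g m m<j)

      join : ∀ ℓ → ((+ G) ∈I I × Above ℓ) ⊎ ((ℤ.- (+ G)) ∈I I × Below ℓ) →
             word (a ℓ) t ⊨ₘ (φ U[ I ] ψ)
      join ℓ (inj₁ (e , j , (h , g) , le)) =
        suc j , s≤s z≤n , transfer ψ j h ,
        far-above {I = I} small ℤₚ.≤-refl (a+G≤b⇒G≤b-a (a ℓ) _ G le) e , between g
      join ℓ (inj₂ (e , j , (h , g) , le)) =
        suc j , s≤s z≤n , transfer ψ j h ,
        far-below {I = I} small ℤₚ.≤-refl (b+G≤a⇒b-a≤-G (a ℓ) _ G le) e , between g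

    above-down : ∀ ℓ → Above (suc ℓ) → Above ℓ
    above-down ℓ (j , c , le) = j , c , ≤-trans (+-monoˡ-≤ G (a-mono ℓ)) le

    below-up : ∀ ℓ → Below ℓ → Below (suc ℓ)
    below-up ℓ (j , c , le) = j , c , ≤-trans le (a-mono ℓ)

  -- `L` collects the exceptional steps. An until contributes two: raising the first datum can only
  -- destroy witnesses above it and only create witnesses below it, and each of these two conditions
  -- changes at most once.
  few-changes : ∀ ψ → outerConstants ψ ≤ G → ∀ N →
                ¬ ¬ (∃ λ L → length L ≡ outer ψ × (∀ ℓ → ℓ < N → ℓ ∉ L → Agree ψ ℓ))
  few-changes (prop p) _ N k = k ([] , refl , λ _ _ _ → id , id)
  few-changes (¬ₘ ψ) small N k = few-changes ψ small N λ { (L , len , h) →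
    k (L , len , λ ℓ ℓ<N ℓ∉L → let f , g = h ℓ ℓ<N ℓ∉L in (_∘ g) , (_∘ f)) }
  few-changes (φ ∧ₘ ψ) small N k =
    few-changes φ (≤-trans (m≤m+n _ _) small) N λ { (L , len , h) →
    few-changes ψ (≤-trans (m≤n+m _ _) small) N λ { (L′ , len′ , h′) →
    k (L ++ L′ , trans (length-++ L) (cong₂ _+_ len len′) , λ ℓ ℓ<N ℓ∉ →
       let f , g   = h ℓ ℓ<N (ℓ∉ ∘ ∈-++⁺ˡ)
           f′ , g′ = h′ ℓ ℓ<N (ℓ∉ ∘ ∈-++⁺ʳ L)
       in (λ { (x , y) → f x , f′ y }) , (λ { (x , y) → g x , g′ y })) } }
  few-changes (φ U[ I ] ψ) small N k =
    decreasing-change (Above φ ψ I) (above-down φ ψ I) N λ { (c , h) →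
    increasing-change (Below φ ψ I) (below-up φ ψ I) N λ { (c′ , h′) →
    k (c ∷ c′ ∷ [] , refl , λ ℓ ℓ<N ℓ∉ →
       (λ u → join φ ψ I small (suc ℓ)
                (Sum.map (map₂ (h ℓ ℓ<N (ℓ∉ ∘ here))) (map₂ (below-up φ ψ I ℓ))
                  (split φ ψ I small ℓ u))) ,
       (λ u → join φ ψ I small ℓ
                (Sum.map (map₂ (above-down φ ψ I ℓ)) (map₂ (h′ ℓ ℓ<N (λ e → ℓ∉ (there (here e)))))
                  (split φ ψ I small (suc ℓ) u)))) } }

¬all-small-∈ : ∀ L → ¬ (∀ ℓ → ℓ < suc (length L) → ℓ ∈ L)
¬all-small-∈ L h with pigeonhole {m = length L} ≤-refl (λ i → index (h (toℕ i) (toℕ<n i)))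
... | i , j , i<j , e = <-irrefl
  (trans (lookup-index (h _ (toℕ<n i))) (trans (cong (List.lookup L) e) (sym (lookup-index (h _ (toℕ<n j)))))) i<j

-- The staircase

even : ℕ → Bool
even zero    = true
even (suc n) = not (even n)

positive negative : Interval
positive = interval (fin (+ 0)) +∞ false true
negative = interval -∞ (fin (+ 0)) true false

-- Register 0 is deliberately not bound here: by the initial valuation it holds the first datum of
-- the word.
stepF crossF : TPTL 1
stepF  = mark ∧ₜ ((0 ∈ᵣ positive) ∧ₜ Xₜ (0 ∈ᵣ negative))
crossF = Fₜ stepF

module _ (B g : ℕ) (u : ℕ → Cell) (u≤B : ∀ j → proj₂ (u j) ≤ B) where

  -- The successor keeps the gap positive, so that the levels strictly increase even when `g` is 0.
  private G = suc g

  height : ℕ → ℕ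
  height n = B + n * G

  height-mono : ∀ {m n} → m ≤ n → height m ≤ height n
  height-mono m≤n = +-monoʳ-≤ B (*-monoˡ-≤ G m≤n)

  height-suc : ∀ n → height n + G ≡ height (suc n)
  height-suc n = trans (+-assoc B (n * G) G) (cong (_+_ B) (+-comm (n * G) G))

  height-< : ∀ {m n} → m < n → height m < height n
  height-< {m} m<n = <-≤-trans (subst (height m <_) (height-suc m) (m<m+n (height m) (s≤s z≤n))) (height-mono m<n)

  -- Stair `m` stands on level `2m` and is marked when `m` is even, and the run `u` follows the
  -- lowest stair. The levels in between are left free for `start`, which takes the odd ones at
  -- distance `G` from the neighbouring even levels.
  staircase : ℕ → ℕ → Cell
  staircase zero    j       = u j
  staircase (suc n) zero    = even (suc n) , height (suc n + suc n)
  staircase (suc n) (suc j) = staircase n j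

  start : ℕ → ℕ
  start ℓ = height (suc (ℓ + ℓ))

  start-mono : ∀ ℓ → start ℓ ≤ start (suc ℓ)
  start-mono ℓ = height-mono (s≤s (+-mono-≤ (n≤1+n ℓ) (n≤1+n ℓ)))

  below-start : ∀ {v} ℓ → v ≤ height (ℓ + ℓ) → v + G ≤ start ℓ
  below-start ℓ v≤ = ≤-trans (+-monoˡ-≤ G v≤) (≤-reflexive (height-suc (ℓ + ℓ)))

  u≤height : ∀ j n → proj₂ (u j) ≤ height n
  u≤height j n = ≤-trans (u≤B j) (m≤m+n B _)

  staircase-far : ∀ n ℓ j → start ℓ + G ≤ proj₂ (staircase n j) ⊎ proj₂ (staircase n j) + G ≤ start ℓ
  staircase-far zero    ℓ j = inj₂ (below-start ℓ (u≤height j (ℓ + ℓ)))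
  staircase-far (suc n) ℓ (suc j) = staircase-far n ℓ j
  staircase-far (suc n) ℓ zero with ≤-<-connex ℓ n
  ... | inj₁ ℓ≤n = inj₁ (≤-trans (≤-reflexive (height-suc (suc (ℓ + ℓ))))
                     (height-mono {suc (suc (ℓ + ℓ))}
                       (s≤s (subst (suc (ℓ + ℓ) ≤_) (sym (+-suc n n)) (s≤s (+-mono-≤ ℓ≤n ℓ≤n))))))
  ... | inj₂ n<ℓ = inj₂ (below-start ℓ (height-mono {suc n + suc n} {ℓ + ℓ} (+-mono-≤ n<ℓ n<ℓ)))

  staircase-+ : ∀ k n j → staircase (k + n) (k + j) ≡ staircase n j
  staircase-+ zero    n j = refl
  staircase-+ (suc k) n j = staircase-+ k n j

  staircase-head : ∀ n → proj₂ (staircase n 0) ≤ height (n + n)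
  staircase-head zero    = u≤height 0 0
  staircase-head (suc n) = ≤-refl

  -- The stairs descend and the run stays below `start ℓ`, so the datum is crossed only once, when
  -- leaving stair `suc ℓ`.
  crossing-parity : ∀ n ℓ j → start ℓ < proj₂ (staircase n j) → proj₂ (staircase n (suc j)) < start ℓ →
                    proj₁ (staircase n j) ≡ even (suc ℓ)
  crossing-parity zero ℓ j hi _ = ⊥-elim (<-irrefl refl (<-≤-trans hi (u≤height j (suc (ℓ + ℓ)))))
  crossing-parity (suc n) ℓ (suc j) hi lo = crossing-parity n ℓ j hi lo
  crossing-parity (suc n) ℓ zero hi lo = cong (even ∘ suc) (≤-antisym (n≤ℓ n lo) ℓ≤n)
    where
      ℓ≤n : ℓ ≤ n
      ℓ≤n with ≤-<-connex ℓ n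
      ... | inj₁ p = p
      ... | inj₂ p = ⊥-elim (<-irrefl refl (<-trans hi (height-< (s≤s (+-mono-≤ p p)))))
      n≤ℓ : ∀ n → proj₂ (staircase n 0) < start ℓ → n ≤ ℓ
      n≤ℓ zero    _  = z≤n
      n≤ℓ (suc n) lo with ≤-<-connex (suc n) ℓ
      ... | inj₁ p = p
      ... | inj₂ (s≤s p) = ⊥-elim (<-irrefl refl (<-≤-trans lo
              (height-mono (s≤s (subst (ℓ + ℓ ≤_) (sym (+-suc n n)) (m≤n⇒m≤1+n (+-mono-≤ p p)))))))

  module _ (n : ℕ) where

    W : ℕ → DataWord 1
    W ℓ = word (start ℓ) (staircase n)

    private
      ν : ℕ → Valuation
      ν ℓ _ = start ℓ

    crossF-even : ∀ ℓ → ℓ < n → even (suc ℓ) ≡ true → W ℓ ⊨ₜ crossF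
    crossF-even ℓ ℓ<n ev = later {w = W ℓ} {ν = ν ℓ} {j = suc k} stepF (s≤s z≤n)
      ( trans (cong proj₁ top) ev
      , (a<b⇒0<b-a (subst (start ℓ <_) (cong proj₂ (sym top))
                      (height-< {suc (ℓ + ℓ)} (s≤s (≤-reflexive (sym (+-suc ℓ ℓ)))))) , tt)
      , next-complete {w = W ℓ} {ν = ν ℓ} (0 ∈ᵣ negative)
          (tt , a<b⇒a-b<0 (subst (_< start ℓ) (cong proj₂ (sym next))
                            (≤-<-trans (staircase-head ℓ) (height-< {ℓ + ℓ} ≤-refl)))) )
      where
        -- The index of stair `suc ℓ`: stair `n` has index 0, and each step goes one stair down.
        k = n ∸ suc ℓ
        at : ∀ j → staircase n (k + j) ≡ staircase (suc ℓ) j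
        at j = trans (cong (λ m → staircase m (k + j)) (sym (m∸n+n≡m ℓ<n))) (staircase-+ k (suc ℓ) j)
        top : staircase n k ≡ staircase (suc ℓ) 0
        top = trans (cong (staircase n) (sym (+-identityʳ k))) (at 0)
        next : staircase n (suc k) ≡ staircase ℓ 0
        next = trans (cong (staircase n) (+-comm 1 k)) (at 1)

    crossF⇒even : ∀ ℓ → W ℓ ⊨ₜ crossF → even (suc ℓ) ≡ true
    crossF⇒even ℓ (suc j , _ , (mk , (hi , _) , nx) , _) =
      trans (sym (crossing-parity n ℓ j (0<b-a⇒a<b hi)
        (a-b<0⇒a<b (proj₂ (next-sound {w = W ℓ} {ν = ν ℓ} (0 ∈ᵣ negative) nx))))) mk

-- Undefinability when a run exists

cellAt : List Cell → ℕ → Cell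
-- The padding is unmarked, as `Reads` demands, and does not raise the bound on the data.
cellAt []       _       = false , 0
cellAt (c ∷ cs) zero    = c
cellAt (c ∷ cs) (suc j) = cellAt cs j

cellAt-bounded : ∀ cs j → proj₂ (cellAt cs j) ≤ sum (map proj₂ cs)
cellAt-bounded []       j       = z≤n
cellAt-bounded (c ∷ cs) zero    = m≤m+n _ _
cellAt-bounded (c ∷ cs) (suc j) = ≤-trans (cellAt-bounded cs j) (m≤n+m _ _)

reads : ∀ {w} i cs → (∀ j → cell w (i + j) ≡ cellAt cs j) → Reads w i cs
reads {w} i [] h j i≤j = trans (cong (λ k → P w k Fin.zero) (sym (m+[n∸m]≡n i≤j))) (cong proj₁ (h (j ∸ i)))
reads {w} i (c ∷ cs) h =
  trans (cong (cell w) (sym (+-identityʳ i))) (h 0) ,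
  reads (suc i) cs λ j → trans (cong (cell w) (sym (+-suc i j))) (h (suc j))

-- The run makes the second conjunct true for every starting datum, so `ψ` would have to follow
-- `crossF`, which alternates at each step and hence more often than `few-changes` allows.
undefinable : ∀ (φ : TPTL 1) cs → (∀ w i ν → Reads w i cs → w ∣ i ∣ ν ⊨ₜ φ) →
              ¬ MTLDefinable (crossF ∧ₜ Fₜ φ)
undefinable φ cs sat (ψ , eqv) =
  few-changes start′ (start-mono B g u u≤B) (staircase-far B g u u≤B n) ψ (n≤1+n g) N
    λ { (L , len , agree) → ¬all-small-∈ L λ ℓ ℓ≤len →
      decidable-stable (ℓ ∈? L) λ ℓ∉L →
        changes ℓ (subst (λ m → ℓ < suc m) len ℓ≤len) (agree ℓ (subst (λ m → ℓ < suc m) len ℓ≤len) ℓ∉L) }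
  where
    open DecMembership _≟_ using (_∈?_)
    B = sum (map proj₂ cs)
    g = outerConstants ψ
    u = cellAt cs
    u≤B = cellAt-bounded cs
    -- One step more than `ψ` has possible changes, so on some step `ψ` stays the same. The `suc N`
    -- stairs provide a crossing for each start from 0 to `N`.
    N = suc (outer ψ)
    n = suc N
    start′ = start B g u u≤B
    W′ = W B g u u≤B n

    -- Position 0 holds the moving datum and the `n` stairs come next, so the run begins at `suc n`.
    reads-run : ∀ ℓ → Reads (W′ ℓ) (suc n) cs
    reads-run ℓ = reads {W′ ℓ} (suc n) cs λ j →
      trans (cong (λ m → staircase B g u u≤B m (n + j)) (sym (+-identityʳ n))) (staircase-+ B g u u≤B n 0 j)

    run : ∀ ℓ → W′ ℓ ⊨ₜ Fₜ φ
    run ℓ = later {w = W′ ℓ} φ (s≤s z≤n) (sat (W′ ℓ) (suc n) (λ _ → start′ ℓ) (reads-run ℓ))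

    ψ⇒even : ∀ ℓ → W′ ℓ ⊨ₘ ψ → even (suc ℓ) ≡ true
    ψ⇒even ℓ h = crossF⇒even B g u u≤B n ℓ (proj₁ (proj₂ (eqv (W′ ℓ)) h))

    even⇒ψ : ∀ ℓ → ℓ < n → even (suc ℓ) ≡ true → W′ ℓ ⊨ₘ ψ
    even⇒ψ ℓ ℓ<n ev = proj₁ (eqv (W′ ℓ)) (crossF-even B g u u≤B n ℓ ℓ<n ev , run ℓ)

    changes : ∀ ℓ → ℓ < N → ¬ ((W′ ℓ ⊨ₘ ψ → W′ (suc ℓ) ⊨ₘ ψ) × (W′ (suc ℓ) ⊨ₘ ψ → W′ ℓ ⊨ₘ ψ))
    changes ℓ ℓ<N (f , b) with even (suc ℓ) in ev
    ... | true  = true≢false (trans (sym (ψ⇒even (suc ℓ) (f (even⇒ψ ℓ (m≤n⇒m≤1+n ℓ<N) ev)))) (cong not ev))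
    ... | false = true≢false (trans (sym (ψ⇒even ℓ (b (even⇒ψ (suc ℓ) (s≤s ℓ<N) (cong not ev))))) ev)

-- Diagonalisation

mutual
  deterministic : ∀ {n} (p : PR n) {xs y z} → p [ xs ]⇓ y → p [ xs ]⇓ z → y ≡ z
  deterministic Z         zero⇓       zero⇓         = refl
  deterministic S         succ⇓       succ⇓         = refl
  deterministic (proj i)  (proj⇓ _)   (proj⇓ _)     = refl
  deterministic (comp f gs) (comp⇓ Ds D) (comp⇓ Es E) with deterministic* gs Ds Es
  ... | refl = deterministic f D E
  deterministic (prec f g) (prec0⇓ D)   (prec0⇓ E)   = deterministic f D E
  deterministic (prec f g) (precS⇓ D D′) (precS⇓ E E′) with deterministic (prec f g) D E
  ... | refl = deterministic g D′ E′
  deterministic (mu f) {y = y} {z} (mu⇓ D pos) (mu⇓ E pos′) with <-cmp y z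
  ... | tri≈ _ y≡z _ = y≡z
  ... | tri< y<z _ _ = ⊥-elim (0≢1+n (deterministic f D (proj₂ (pos′ y y<z))))
  ... | tri> _ _ z<y = ⊥-elim (0≢1+n (deterministic f E (proj₂ (pos z z<y))))

  deterministic* : ∀ {k n} (ps : Vec (PR n) k) {xs ys zs} → ps [ xs ]⇓* ys → ps [ xs ]⇓* zs → ys ≡ zs
  deterministic* []       []⇓       []⇓       = refl
  deterministic* (p ∷ ps) (D ∷⇓ Ds) (E ∷⇓ Es) = cong₂ _∷_ (deterministic p D E) (deterministic* ps Ds Es)

-- Computing the code of the diagonal formula

double : PR 1
double = prec Z (comp S (comp S (proj (Fin.suc Fin.zero) ∷ []) ∷ []))

double⇓ : ∀ x → double [ x ∷ [] ]⇓ (2 * x)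
double⇓ zero    = prec0⇓ zero⇓
double⇓ (suc x) = subst (double [ suc x ∷ [] ]⇓_) (sym (cong suc (+-suc x (x + 0))))
  (precS⇓ (double⇓ x) (comp⇓ (comp⇓ (proj⇓ _ ∷⇓ []⇓) succ⇓ ∷⇓ []⇓) succ⇓))

pairing : PR 2
pairing = prec double (comp S (comp double (proj (Fin.suc Fin.zero) ∷ []) ∷ []))

pair-zero : ∀ b → pair 0 b ≡ 2 * b
pair-zero b = trans (cong (_∸ 1) (*-identityˡ (2 * b + 1))) (m+n∸n≡m (2 * b) 1)

-- Rests on 2q - 1 = 2(q - 1) + 1 for positive q. This recursion in the first argument lets
-- `pairing` avoid powers and subtraction.
pair-suc : ∀ a b → pair (suc a) b ≡ suc (2 * pair a b)
pair-suc a b = trans (cong (_∸ 1) (*-assoc 2 (2 ^ a) (2 * b + 1)))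
                 (halve (2 ^ a * (2 * b + 1)) (*-mono-≤ (m^n>0 2 a) (m≤n+m 1 (2 * b))))
  where
    halve : ∀ q → 1 ≤ q → 2 * q ∸ 1 ≡ suc (2 * (q ∸ 1))
    halve (suc q) _ = +-suc q (q + 0)

pairing⇓ : ∀ a b → pairing [ a ∷ b ∷ [] ]⇓ pair a b
pairing⇓ zero    b = subst (pairing [ 0 ∷ b ∷ [] ]⇓_) (sym (pair-zero b)) (prec0⇓ (double⇓ b))
pairing⇓ (suc a) b = subst (pairing [ suc a ∷ b ∷ [] ]⇓_) (sym (pair-suc a b))
  (precS⇓ (pairing⇓ a b) (comp⇓ (comp⇓ (proj⇓ _ ∷⇓ []⇓) (double⇓ _) ∷⇓ []⇓) succ⇓))

Computable : (TPTL 1 → ℕ) → Set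
Computable f = Σ (PR 1) λ p → ∀ R → p [ encTPTL R ∷ [] ]⇓ f R

constant : ∀ c → Computable (λ _ → c)
constant zero    = Z , λ _ → zero⇓
constant (suc c) with constant c
... | p , h = comp S (p ∷ []) , λ R → comp⇓ (h R ∷⇓ []⇓) succ⇓

identity : Computable encTPTL
identity = proj Fin.zero , λ R → proj⇓ Fin.zero

doubled : ∀ {f} → Computable f → Computable (λ R → 2 * f R)
doubled (p , h) = comp double (p ∷ []) , λ R → comp⇓ (h R ∷⇓ []⇓) (double⇓ _)

paired : ∀ {f g} → Computable f → Computable g → Computable (λ R → pair (f R) (g R))
paired (p , h) (q , h′) = comp pairing (p ∷ q ∷ []) , λ R → comp⇓ (h R ∷⇓ (h′ R ∷⇓ []⇓)) (pairing⇓ _ _)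

module _ (f g : TPTL 1 → TPTL 1) where

  conjunction : Computable (λ R → encTPTL (f R)) → Computable (λ R → encTPTL (g R)) →
                Computable (λ R → encTPTL (f R ∧ₜ g R))
  conjunction p q = paired (constant 3) (paired p q)

  until : Computable (λ R → encTPTL (f R)) → Computable (λ R → encTPTL (g R)) →
          Computable (λ R → encTPTL (f R Uₜ g R))
  until p q = paired (constant 4) (paired p q)

binding : ∀ r (f : TPTL 1 → TPTL 1) → Computable (λ R → encTPTL (f R)) →
          Computable (λ R → encTPTL (bind r (f R)))
binding r f p = paired (constant 5) (paired (constant r) p)

testing : ∀ r (f : TPTL 1 → ℕ) → Computable f → Computable (λ R → encTPTL {1} (r ∈ᵣ point (f R)))
-- Both endpoints have the same code, and `pair 1 1` encodes the two closedness flags.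
testing r f p = paired (constant 1) (paired (constant r) (paired (paired endpoint endpoint) (constant (pair 1 1))))
  where
    endpoint : Computable (λ R → encBound (fin (ℤ.+ f R)))
    endpoint = paired (constant 2) (doubled p)

-- The subformulas ψ, T and F, as well as Ψ in no-decider, are kept abstract so that
-- the type checker never evaluates their astronomically large codes.
module _ (ψ T F : TPTL 1) where

  input run eventually diagonal : TPTL 1 → TPTL 1
  input R      = F Uₜ (0 ∈ᵣ point (encTPTL R))
  run R        = bind 0 (R ∧ₜ input R)
  eventually R = T Uₜ run R
  diagonal R   = ψ ∧ₜ eventually R

  diagonal-computable : Computable (λ R → code 1 (diagonal R))
  diagonal-computable = paired (constant 1) (conjunction (λ _ → ψ) eventually (constant (encTPTL ψ)) eventually-c)
    where
      input-c : Computable (λ R → encTPTL (input R))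
      input-c = until (λ _ → F) (λ R → 0 ∈ᵣ point (encTPTL R)) (constant (encTPTL F)) (testing 0 encTPTL identity)
      run-c : Computable (λ R → encTPTL (run R))
      run-c = binding 0 (λ R → R ∧ₜ input R) (conjunction (λ R → R) input identity input-c)
      eventually-c : Computable (λ R → encTPTL (eventually R))
      eventually-c = until (λ _ → T) run (constant (encTPTL T)) run-c

-- Refuting a decision procedure

Simulates : TPTL 1 → PR 1 → Set
Simulates R p = ∀ x →
  (∀ w i ν → w ∣ i ∣ ν ⊨ₜ runF R x → ¬ ¬ p [ x ∷ [] ]⇓ 1) ×
  (p [ x ∷ [] ]⇓ 1 → ∃ λ cs → ∀ w i ν → Reads w i cs → w ∣ i ∣ ν ⊨ₜ runF R x)

-- One formula serves all inputs, because `x` enters only through the datum test that `runF` adds.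
simulation : ∀ p → Σ (TPTL 1) λ R → Simulates R p
simulation p with compile [] p
... | Γ , _ , m , I = machineF Γ m , λ x → (λ w i ν → run-sound {w} {i} {ν} I) , run-complete I

module _ (Ψ : TPTL 1 → TPTL 1) (computable : Computable (λ R → code 1 (Ψ R)))
         (Ψ-def : ∀ R → Ψ R ≡ crossF ∧ₜ Fₜ (runF R (encTPTL R))) where

  -- `D` is built before `R`, since it computes the code of `Ψ R` from that of `R`; so the formula
  -- simulating `D` can be fed its own code. If `Ψ R` were definable, `D` would output 1, a run
  -- would exist and `undefinable` would apply. Hence `e` answers 0, determinism excludes the output
  -- 1, and `Ψ R` has no model, which makes it definable after all.
  no-decider : ∀ e → ¬ DecidesMTLDefinability e
  no-decider e decides = refute (simulation D)
    where
      D = comp e (proj₁ computable ∷ [])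

      refute : ¬ Σ (TPTL 1) λ R → Simulates R D
      refute (R , simulates) = undef definable
        where
          D⇓ : ∀ {y} → e [ code 1 (Ψ R) ∷ [] ]⇓ y → D [ encTPTL R ∷ [] ]⇓ y
          D⇓ h = comp⇓ (proj₂ computable R ∷⇓ []⇓) h

          undef : ¬ MTLDefinable (Ψ R)
          undef def with proj₂ (simulates (encTPTL R)) (D⇓ (proj₁ (decides 1 (Ψ R)) def))
          ... | cs , sat = undefinable (runF R (encTPTL R)) cs sat (subst MTLDefinable (Ψ-def R) def)

          unsatisfiable : ∀ w → ¬ w ⊨ₜ Ψ R
          unsatisfiable w h with subst (w ⊨ₜ_) (Ψ-def R) h
          ... | _ , i , _ , run , _ = proj₁ (simulates (encTPTL R)) w i _ run λ D⇓1 →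
            0≢1+n (deterministic D (D⇓ (proj₂ (decides 1 (Ψ R)) undef)) D⇓1)

          definable : MTLDefinable (Ψ R)
          definable = prop Fin.zero ∧ₘ (¬ₘ prop Fin.zero) ,
            λ w → (λ h → ⊥-elim (unsatisfiable w h)) , λ { (p , ¬p) → ⊥-elim (¬p p) }

theorem3 : ¬ (Σ (PR 1) λ e → DecidesMTLDefinability e)
theorem3 (e , decides) =
  no-decider (diagonal crossF ⊤ₜ ⊥ₜ) (diagonal-computable crossF ⊤ₜ ⊥ₜ) (λ _ → refl) e decides
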